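{- For all nonnegative integers $n,k$ with $0\le k\le n$, \[ \sum_{\pi \in \mathfrak{S}_{n}^k}q^{{\rm inv}(\pi)}\prod_{i \in {\rm Des}(\pi)}\left(1+\frac{z}{q^{1+{\rm inv}^{\Box,i}(\pi)}}\right) = \sum_{\pi \in \mathfrak{S}_{n}^k}q^{{\rm maj}(\pi)}\prod_{i=1}^{{\rm des}(\pi)}\left(1+\frac{z}{q^{i}} \right), \] where $q,z$ are indeterminates.
   Context: A partial permutation (Laguerre word) in $\mathfrak{S}_n^k$ is a word $\pi=\pi_1\pi_2\cdots\pi_n$ of length $n$ in which exactly $k$ letters are a hole symbol $\lozenge$ and the other $n-k$ letters are distinct elements of $[n]=\{1,\dots,n\}$. Letters are ordered $1<2<\cdots<n<\lozenge$. Let $S_\pi\subseteq[n]$ be the set of numerical letters of $\pi$ and $\overline S_\pi=[n]\setminus S_\pi$. For disjoint sets $A,B$ of integers, ${\rm inv}(A,B)=|\{(a,b)\in A\times B: a>b\}|$. For $i\in[n]$, ${\rm inv}^{\Box,i}(\pi)=|\{j: 1\le j<i,\ \pi_j>\pi_i\}|$, and ${\rm inv}_0(\pi)=\sum_{i=1}^n {\rm inv}^{\Box,i}(\pi)$. The descent set is ${\rm Des}(\pi)=\{i\in[n-1]:\pi_i>\pi_{i+1}\}$, ${\rm des}(\pi)=|{\rm Des}(\pi)|$, and ${\rm maj}_0(\pi)=\sum_{i\in{\rm Des}(\pi)} i$. Define ${\rm inv}(\pi)={\rm inv}_0(\pi)+{\rm inv}(S_\pi,\overline S_\pi)$ and ${\rm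 maj}(\pi)={\rm maj}_0(\pi)+{\rm inv}(S_\pi,\overline S_\pi)$. -}

module Defs where

open import Data.Nat using (ℕ; zero; suc; _∸_; _≡ᵇ_; _<ᵇ_)
import Data.Nat
open Data.Nat using () renaming (_+_ to _+ℕ_)
open import Data.Bool using (Bool; true; false; _∧_; not; if_then_else_)
open import Data.Maybe using (Maybe; just; nothing)
open import Data.Fin using (Fin; toℕ)
open import Data.List using (List; []; _∷_; _++_; map; foldr; filter; take; concatMap; applyUpTo)
open import Data.List.Base using (allFin)
open import Data.Vec using (Vec; toList) renaming ([] to []ᵥ; _∷_ to _∷ᵥ_)
open import Data.Product using (_×_; _,_)
open import Algebra.Bundles using (CommutativeRing)
open import Level using (Level)

-- Letters of a Laguerre word over [n]: a numerical letter  just a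
-- (a : Fin n, representing the integer toℕ a + 1) or the hole  nothing.
-- Order: 1 < 2 < ... < n < hole.

Letter : ℕ → Set
Letter n = Maybe (Fin n)

_>ᴸ_ : ∀ {n} → Letter n → Letter n → Bool
just a  >ᴸ just b  = toℕ b <ᵇ toℕ a
just _  >ᴸ nothing = false
nothing >ᴸ just _  = true
nothing >ᴸ nothing = false

countB : ∀ {A : Set} → (A → Bool) → List A → ℕ
countB p []      = 0
countB p (x ∷ r) = (if p x then 1 else 0) +ℕ countB p r

anyB : ∀ {A : Set} → (A → Bool) → List A → Bool
anyB p []      = false
anyB p (x ∷ r) = if p x then true else anyB p r

isHole : ∀ {n} → Letter n → Bool
isHole nothing  = true
isHole (just _) = false

numerals : ∀ {n} → List (Letter n) → List (Fin n)
numerals []             = []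
numerals (nothing ∷ r)  = numerals r
numerals (just a ∷ r)   = a ∷ numerals r

_≡ᶠ_ : ∀ {n} → Fin n → Fin n → Bool
a ≡ᶠ b = toℕ a ≡ᵇ toℕ b

allDistinct : ∀ {n} → List (Fin n) → Bool
allDistinct []      = true
allDistinct (a ∷ r) = not (anyB (a ≡ᶠ_) r) ∧ allDistinct r

Word : ℕ → Set
Word n = Vec (Letter n) n

allVecs : ∀ {A : Set} → List A → (m : ℕ) → List (Vec A m)
allVecs xs zero    = []ᵥ ∷ []
allVecs xs (suc m) = concatMap (λ x → map (x ∷ᵥ_) (allVecs xs m)) xs

allLetters : (n : ℕ) → List (Letter n)
allLetters n = nothing ∷ map just (allFin n)

isPartialPerm : ∀ {n} → ℕ → Word n → Bool
isPartialPerm k π = (countB isHole (toList π) ≡ᵇ k) ∧ allDistinct (numerals (toList π))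

-- the finite set 𝔖ₙᵏ, as a duplicate-free list
PP : (n k : ℕ) → List (Word n)
PP n k = filter? (allVecs (allLetters n) n)
  where
  filter? : List (Word n) → List (Word n)
  filter? []      = []
  filter? (π ∷ r) = if isPartialPerm k π then π ∷ filter? r else filter? r

-- Statistics.  Positions are 1-based, as in the paper.

nth : ∀ {A : Set} → ℕ → List A → Maybe A
nth _       []      = nothing
nth zero    (x ∷ _) = just x
nth (suc i) (_ ∷ r) = nth i r

invBox : ∀ {n} → Word n → ℕ → ℕ
invBox π i with nth (i ∸ 1) (toList π)
... | nothing = 0
... | just x  = countB (λ y → y >ᴸ x) (take (i ∸ 1) (toList π))

inv₀ : ∀ {n} → Word n → ℕ
inv₀ {n} π = foldr _+ℕ_ 0 (map (invBox π) (applyUpTo suc n))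

descentsFrom : ∀ {n} → ℕ → List (Letter n) → List ℕ
descentsFrom o (x ∷ y ∷ r) =
  (if x >ᴸ y then suc o ∷ [] else []) ++ descentsFrom (suc o) (y ∷ r)
descentsFrom o _ = []

Des : ∀ {n} → Word n → List ℕ
Des π = descentsFrom 0 (toList π)

des : ∀ {n} → Word n → ℕ
des π = countB (λ _ → true) (Des π)

maj₀ : ∀ {n} → Word n → ℕ
maj₀ π = foldr _+ℕ_ 0 (Des π)

inS : ∀ {n} → Word n → Fin n → Bool
inS π a = anyB (a ≡ᶠ_) (numerals (toList π))

invSS : ∀ {n} → Word n → ℕ
invSS {n} π =
  countB (λ { (a , b) → inS π a ∧ not (inS π b) ∧ (toℕ b <ᵇ toℕ a) })
         (concatMap (λ a → map (a ,_) (allFin n)) (allFin n))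

inv : ∀ {n} → Word n → ℕ
inv π = inv₀ π +ℕ invSS π

maj : ∀ {n} → Word n → ℕ
maj π = maj₀ π +ℕ invSS π

-- The two generating functions, evaluated in a commutative ring R
-- at q, z, with q⁻¹ an element (assumed inverse to q in the statement).

module Gen {c ℓ : Level} (R : CommutativeRing c ℓ) where
  open CommutativeRing R
  open import Algebra.Bundles using (Semiring)
  open import Algebra.Definitions.RawSemiring (Semiring.rawSemiring semiring) using (_^_)

  Σ[_] : List Carrier → Carrier
  Σ[ xs ] = foldr _+_ 0# xs

  Π[_] : List Carrier → Carrier
  Π[ xs ] = foldr _*_ 1# xs

  LHS : (q q⁻¹ z : Carrier) → ℕ → ℕ → Carrier
  LHS q q⁻¹ z n k =
    Σ[ map (λ π → (q ^ inv π) *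
                  Π[ map (λ i → 1# + z * (q⁻¹ ^ suc (invBox π i))) (Des π) ])
           (PP n k) ]

  RHS : (q q⁻¹ z : Carrier) → ℕ → ℕ → Carrier
  RHS q q⁻¹ z n k =
    Σ[ map (λ π → (q ^ maj π) *
                  Π[ map (λ i → 1# + z * (q⁻¹ ^ i)) (applyUpTo suc (des π)) ])
           (PP n k) ]

{-# OPTIONS --safe #-}
-- Put y = z/q.  Without the factor q^inv(S,S̄), the left-hand summand of a word is
-- ∏ᵢ (q^{inv^{□,i}} + y [i ∈ Des]); homogenise it to ∏ᵢ (x q^{inv^{□,i}} + y [i ∈ Des]).
-- Summed over all ways of inserting a new largest letter into a word, this polynomial changes by
--   T : x^K y^r ↦ [K+1] x^{K+1} y^r + q [K] x^K y^{r+1},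
-- where [K] is the q-integer.  The right-hand summand, homogenised to
-- q^maj x^{n-des} ∏_{i ≤ des} (x + y q^{1-i}), changes by the same T when a new smallest letter is
-- inserted, by Carlitz's insertion argument.  Build the words with numerals S and k holes in two
-- ways: for maj, start from the k holes and insert S in decreasing order, which gives T^|S| x^k;
-- for inv, insert S in increasing order into the empty word and shuffle in the holes at the end,
-- which gives C_k T^|S| x^0 for an operator C_k that commutes with T and sends x^0 to x^k.  The
-- two sums agree for every S, and inv(S,S̄) depends only on S.
module Submission where

open import Defs
open import Data.Nat using (ℕ; _≤_)
open import Algebra.Bundles using (CommutativeRing)
open import Level using (Level)

open import Algebra.Bundles using (Semiring)
open import Data.Bool using (Bool; true; false; if_then_else_; _∧_; not)
open import Data.Bool.Properties using (T-≡)
open import Data.Empty using (⊥-elim)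
open import Data.Fin using (Fin; toℕ)
open import Data.List using (List; []; _∷_; _++_; _∷ʳ_; map; foldr; concatMap; applyUpTo;
  allFin; filterᵇ; length; replicate; take)
import Data.List.Properties as List
open import Data.List.Relation.Binary.Permutation.Propositional as ↭
  using (_↭_; prep; swap; ↭-refl; ↭-sym; ↭-trans; ↭-reflexive)
open import Data.List.Relation.Binary.Permutation.Propositional.Properties
  using (shift; ++-comm; All-resp-↭)
open import Data.List.Relation.Binary.Sublist.Propositional using (_⊆_; []; _∷_)
  renaming (_∷ʳ_ to skip)
open import Data.List.Relation.Binary.Sublist.Propositional.Properties using (All-resp-⊆)
open import Data.List.Relation.Unary.All as All using (All; []; _∷_)
import Data.List.Relation.Unary.All.Properties as All
open import Data.List.Relation.Unary.AllPairs as AllPairs using (AllPairs; []; _∷_)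
import Data.List.Relation.Unary.AllPairs.Properties as AllPairs
open import Data.Maybe using (just; nothing)
open import Data.Nat using (zero; suc; _≡ᵇ_; _<ᵇ_) renaming (_+_ to _+ℕ_; _<_ to _<ℕ_)
open import Data.Nat.Properties
  using (≡ᵇ⇒≡; ≡⇒≡ᵇ; <⇒≢; <⇒<ᵇ; <ᵇ⇒<; <-asym; +-commutativeSemigroup)
  renaming (+-suc to +ℕ-suc; +-identityʳ to +ℕ-identityʳ; +-assoc to +ℕ-assoc;
    +-comm to +ℕ-comm)
open import Algebra.Properties.CommutativeSemigroup +-commutativeSemigroup using (x∙yz≈y∙xz)
open import Data.Product using (_×_; _,_; proj₁; proj₂)
import Data.Vec as Vec
open Vec using (Vec; toList)
import Data.Vec.Properties as Vec
open import Function using (_∘_; id; Equivalence)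
open import Level using (_⊔_)
open import Relation.Binary.PropositionalEquality as ≡ using (_≡_; _≢_)

-- Counting, filtering and rearranging lists.

suc-+ℕ-assoc : ∀ a b c → suc (a +ℕ (b +ℕ c)) ≡ (a +ℕ b) +ℕ suc c
suc-+ℕ-assoc a b c = ≡.trans (≡.cong suc (≡.sym (+ℕ-assoc a b c))) (≡.sym (+ℕ-suc (a +ℕ b) c))

anyB-↭ : ∀ {A : Set} (p : A → Bool) {xs ys} → xs ↭ ys → anyB p xs ≡ anyB p ys
anyB-↭ p ↭.refl        = ≡.refl
anyB-↭ p (prep x r)    = ≡.cong (if p x then true else_) (anyB-↭ p r)
anyB-↭ p (swap x y r) with p x | p y
... | true  | true  = ≡.refl
... | true  | false = ≡.refl
... | false | true  = ≡.refl
... | false | false = anyB-↭ p r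
anyB-↭ p (↭.trans r s) = ≡.trans (anyB-↭ p r) (anyB-↭ p s)

countB-↭ : ∀ {A : Set} (p : A → Bool) {xs ys} → xs ↭ ys → countB p xs ≡ countB p ys
countB-↭ p ↭.refl        = ≡.refl
countB-↭ p (prep x r)    = ≡.cong ((if p x then 1 else 0) +ℕ_) (countB-↭ p r)
countB-↭ p (swap x y r) rewrite countB-↭ p r with p x | p y
... | true  | true  = ≡.refl
... | true  | false = ≡.refl
... | false | true  = ≡.refl
... | false | false = ≡.refl
countB-↭ p (↭.trans r s) = ≡.trans (countB-↭ p r) (countB-↭ p s)

countB-cong : ∀ {A : Set} {p p′ : A → Bool} → (∀ x → p x ≡ p′ x) →
  ∀ xs → countB p xs ≡ countB p′ xs
countB-cong e []       = ≡.refl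
countB-cong e (x ∷ xs) = ≡.cong₂ (λ b m → (if b then 1 else 0) +ℕ m) (e x) (countB-cong e xs)

countB-∷ʳ : ∀ {A : Set} (p : A → Bool) xs x →
  countB p (xs ∷ʳ x) ≡ (if p x then 1 else 0) +ℕ countB p xs
countB-∷ʳ p xs x = countB-↭ p (++-comm xs (x ∷ []))

-- The equations of a filter determine it. They are taken as hypotheses so that the lemma applies to
-- the filter local to `PP`.
filterᵇ-unique : ∀ {A : Set} (p : A → Bool) (filt : List A → List A) → filt [] ≡ [] →
  (∀ x xs → filt (x ∷ xs) ≡ (if p x then x ∷ filt xs else filt xs)) →
  ∀ xs → filt xs ≡ filterᵇ p xs
filterᵇ-unique p filt nil step []       = nil
filterᵇ-unique p filt nil step (x ∷ xs) rewrite step x xs | filterᵇ-unique p filt nil step xs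
  with p x
... | true  = ≡.refl
... | false = ≡.refl

AllPairs-resp-⊆ : ∀ {A : Set} {P : A → A → Set} {xs ys} → xs ⊆ ys →
  AllPairs P ys → AllPairs P xs
AllPairs-resp-⊆ []           []       = []
AllPairs-resp-⊆ (skip y p)   (_ ∷ ps) = AllPairs-resp-⊆ p ps
AllPairs-resp-⊆ (≡.refl ∷ p) (x ∷ ps) = All-resp-⊆ p x ∷ AllPairs-resp-⊆ p ps

nth-length : ∀ {A : Set} (p : List A) a w → nth (length p) (p ++ a ∷ w) ≡ just a
nth-length []      a w = ≡.refl
nth-length (_ ∷ p) a w = nth-length p a w

take-length : ∀ {A : Set} (p w : List A) → take (length p) (p ++ w) ≡ p
take-length []      w = ≡.refl
take-length (x ∷ p) w = ≡.cong (x ∷_) (take-length p w)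

-- Descents, ascents and the major index over an alphabet with a Boolean comparison.

module Words {X : Set} (_≻_ : X → X → Bool) where

  -- No order axioms are imposed on `_≻_`, so both truth values are recorded.
  _≺_ : X → X → Set
  a ≺ b = b ≻ a ≡ true × a ≻ b ≡ false

  descends : X → List X → Bool
  descends a []      = false
  descends a (b ∷ w) = a ≻ b

  _⊕_ : (X → ℕ) → X → X → ℕ
  (n ⊕ a) x = (if a ≻ x then 1 else 0) +ℕ n x

  -- The last position counts as an ascent, so `ascents` is the length minus `descents`. A descent
  -- at position i lies in exactly i suffixes, so adding up `descents` over all suffixes gives the
  -- major index.
  descents ascents major : List X → ℕ
  descents []      = 0
  descents (a ∷ w) = (if descends a w then 1 else 0) +ℕ descents w
  ascents []      = 0
  ascents (a ∷ w) = (if descends a w then 0 else 1) +ℕ ascents w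
  major []      = 0
  major (a ∷ w) = descents (a ∷ w) +ℕ major w

-- Letters of Laguerre words: occurrence and order.

numerals-↭ : ∀ {m} {u v : List (Letter m)} → u ↭ v → numerals u ↭ numerals v
numerals-↭ ↭.refl                         = ↭.refl
numerals-↭ (prep nothing r)               = numerals-↭ r
numerals-↭ (prep (just a) r)              = prep a (numerals-↭ r)
numerals-↭ (swap nothing  nothing  r)     = numerals-↭ r
numerals-↭ (swap nothing  (just b) r)     = prep b (numerals-↭ r)
numerals-↭ (swap (just a) nothing  r)     = prep a (numerals-↭ r)
numerals-↭ (swap (just a) (just b) r)     = swap a b (numerals-↭ r)
numerals-↭ (↭.trans r s)                  = ↭.trans (numerals-↭ r) (numerals-↭ s)

occurs : ∀ {n} → List (Letter n) → Fin n → Bool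
occurs w a = anyB (a ≡ᶠ_) (numerals w)

occurs-↭ : ∀ {n} {u v : List (Letter n)} → u ↭ v → ∀ a → occurs u a ≡ occurs v a
occurs-↭ r a = anyB-↭ (a ≡ᶠ_) (numerals-↭ r)

Apart : ∀ {n} → Fin n → Fin n → Set
Apart a b = (a ≡ᶠ b) ≡ false × (b ≡ᶠ a) ≡ false

≢⇒≡ᶠ-false : ∀ {n} {a b : Fin n} → toℕ a ≢ toℕ b → (a ≡ᶠ b) ≡ false
≢⇒≡ᶠ-false {a = a} {b} a≢b with toℕ a ≡ᵇ toℕ b in eq
... | false = ≡.refl
... | true  = ⊥-elim (a≢b (≡ᵇ⇒≡ _ _ (Equivalence.from T-≡ eq)))

<⇒Apart : ∀ {n} {a b : Fin n} → toℕ a <ℕ toℕ b → Apart a b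
<⇒Apart a<b = ≢⇒≡ᶠ-false (<⇒≢ a<b) , ≢⇒≡ᶠ-false (<⇒≢ a<b ∘ ≡.sym)

≡ᶠ-refl : ∀ {n} (a : Fin n) → (a ≡ᶠ a) ≡ true
≡ᶠ-refl a = Equivalence.to T-≡ (≡⇒≡ᵇ (toℕ a) (toℕ a) ≡.refl)

_≺ᴸ_ : ∀ {n} → Letter n → Letter n → Set
_≺ᴸ_ = Words._≺_ _>ᴸ_

>ᴸ-irrefl : ∀ {n} (a : Letter n) → (a >ᴸ a) ≡ false
>ᴸ-irrefl nothing  = ≡.refl
>ᴸ-irrefl (just a) = n<ᵇn (toℕ a)
  where
  n<ᵇn : ∀ m → (m <ᵇ m) ≡ false
  n<ᵇn zero    = ≡.refl
  n<ᵇn (suc m) = n<ᵇn m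

<⇒≺ᴸ : ∀ {n} {a b : Fin n} → toℕ a <ℕ toℕ b → just a ≺ᴸ just b
<⇒≺ᴸ {a = a} {b} a<b = Equivalence.to T-≡ (<⇒<ᵇ a<b) , b≮a
  where
  b≮a : (toℕ b <ᵇ toℕ a) ≡ false
  b≮a with toℕ b <ᵇ toℕ a in eq
  ... | false = ≡.refl
  ... | true  = ⊥-elim (<-asym a<b (<ᵇ⇒< _ _ (Equivalence.from T-≡ eq)))

-- Partial permutations and their statistics as functions of lists.

module _ {n k : ℕ} where
  mutual
    -- The placeholder is the filter local to PP, which has no name outside Defs; it is found by
    -- unification in PP≡filterᵇ.
    PP-filter : let filt : List (Word n) → List (Word n) ; filt = _ in
      ∀ xs → filt xs ≡ filterᵇ (isPartialPerm k) xs
    PP-filter = filterᵇ-unique (isPartialPerm k) _ ≡.refl (λ _ _ → ≡.refl)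

    PP≡filterᵇ : PP n k ≡ filterᵇ (isPartialPerm k) (allVecs (allLetters n) n)
    -- With a variable in place of the list of words, unification determines the placeholder
    -- uniquely.
    PP≡filterᵇ with allVecs (allLetters n) n
    ... | words = PP-filter words

-- `invSS` for a list of any length, as insertion passes through words shorter and longer than n. It
-- sees a word only through the set of its numerals.
invLetters : ∀ {n} → List (Letter n) → ℕ
invLetters {n} w = countB (λ (a , b) → occurs w a ∧ not (occurs w b) ∧ (toℕ b <ᵇ toℕ a))
  (concatMap (λ a → map (a ,_) (allFin n)) (allFin n))

invSS≡invLetters : ∀ {n} (π : Word n) → invSS π ≡ invLetters (toList π)
invSS≡invLetters {n} π = countB-cong (λ (a , b) → ≡.refl)
  (concatMap (λ a → map (a ,_) (allFin n)) (allFin n))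

invLetters-↭ : ∀ {n} {u v : List (Letter n)} → u ↭ v → invLetters u ≡ invLetters v
invLetters-↭ {n} r = countB-cong
  (λ (a , b) → ≡.cong₂ (λ s t → s ∧ not t ∧ (toℕ b <ᵇ toℕ a)) (occurs-↭ r a) (occurs-↭ r b))
  (concatMap (λ a → map (a ,_) (allFin n)) (allFin n))

invBox-at : ∀ {n} (π : Word n) p a w → toList π ≡ p ++ a ∷ w →
  invBox π (suc (length p)) ≡ countB (_>ᴸ a) p
invBox-at π p a w e
  rewrite ≡.trans (≡.cong (nth (length p)) e) (nth-length p a w) =
  ≡.cong (countB (_>ᴸ a)) (≡.trans (≡.cong (take (length p)) e) (take-length p (a ∷ w)))

module _ {n : ℕ} where
  open Words (_>ᴸ_ {n})

  des≡descents : ∀ o w → countB (λ _ → true) (descentsFrom o w) ≡ descents w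
  des≡descents o []          = ≡.refl
  des≡descents o (a ∷ [])    = ≡.refl
  des≡descents o (a ∷ b ∷ w) with a >ᴸ b | des≡descents (suc o) (b ∷ w)
  ... | true  | e = ≡.cong suc e
  ... | false | e = e

  -- Raising the offset moves each descent one place to the right, which adds one per descent.
  sum-descentsFrom-suc : ∀ o w → foldr _+ℕ_ 0 (descentsFrom (suc o) w) ≡
    descents w +ℕ foldr _+ℕ_ 0 (descentsFrom o w)
  sum-descentsFrom-suc o []          = ≡.refl
  sum-descentsFrom-suc o (a ∷ [])    = ≡.refl
  sum-descentsFrom-suc o (a ∷ b ∷ w) with a >ᴸ b | sum-descentsFrom-suc (suc o) (b ∷ w)
  ... | false | e = e
  ... | true  | e = ≡.trans (≡.cong (suc (suc o) +ℕ_) e)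
    (≡.cong suc (x∙yz≈y∙xz (suc o) (descents (b ∷ w)) _))

  maj₀≡major : ∀ w → foldr _+ℕ_ 0 (descentsFrom 0 w) ≡ major w
  maj₀≡major []          = ≡.refl
  maj₀≡major (a ∷ [])    = ≡.refl
  maj₀≡major (a ∷ b ∷ w) with a >ᴸ b | ≡.trans (sum-descentsFrom-suc 0 (b ∷ w))
      (≡.cong (descents (b ∷ w) +ℕ_) (maj₀≡major (b ∷ w)))
  ... | true  | e = ≡.cong suc e
  ... | false | e = e

-- Polynomials as functionals; the operators T and C and their commutation.

module Insertion {c ℓ} (R : CommutativeRing c ℓ) (q q⁻¹ y : CommutativeRing.Carrier R)
  (q*q⁻¹≈1 : CommutativeRing._≈_ R (CommutativeRing._*_ R q q⁻¹) (CommutativeRing.1# R)) where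

  open CommutativeRing R hiding (zero)
  open import Algebra.Definitions.RawSemiring (Semiring.rawSemiring semiring) using (_^_)
  open import Algebra.Properties.Semiring.Exp semiring using (^-homo-*; ^-congʳ)
  open import Algebra.Properties.CommutativeSemiring.Exp commutativeSemiring using (^-distrib-*)
  open import Algebra.Solver.Ring.NaturalCoefficients.Default commutativeSemiring
    using (solve; _:=_; _:+_; _:*_; con)
  open import Relation.Binary.Reasoning.Setoid setoid

  -- A polynomial Σ c_{K,r} x^K y^r is represented by the functional g ↦ Σ c_{K,r} y^r g(K).
  Functional : Set c
  Functional = (ℕ → Carrier) → Carrier

  -- An arbitrary `Functional` need not come from a polynomial; these are the properties of such
  -- functionals that the proofs rely on.
  record Linear (L : Functional) : Set (c ⊔ ℓ) where
    field
      cong  : ∀ {g h} → (∀ K → g K ≈ h K) → L g ≈ L h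
      add   : ∀ g h → L (λ K → g K + h K) ≈ L g + L h
      scale : ∀ a g → L (λ K → a * g K) ≈ a * L g

  open Linear

  eval-linear : ∀ m → Linear (λ g → g m)
  eval-linear m .cong  e   = e m
  eval-linear m .add   g h = refl
  eval-linear m .scale a g = refl

  suc-linear : ∀ {L} → Linear L → Linear (λ g → L (g ∘ suc))
  suc-linear l .cong  e   = cong l (e ∘ suc)
  suc-linear l .add   g h = add l (g ∘ suc) (h ∘ suc)
  suc-linear l .scale a g = scale l a (g ∘ suc)

  +-linear : ∀ {L M} → Linear L → Linear M → Linear (λ g → L g + M g)
  +-linear l m .cong  e   = +-cong (cong l e) (cong m e)
  +-linear {L} {M} l m .add g h = trans (+-cong (add l g h) (add m g h))
    (solve 4 (λ a b c d → (a :+ b) :+ (c :+ d) := (a :+ c) :+ (b :+ d)) refl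
       (L g) (L h) (M g) (M h))
  +-linear l m .scale a g =
    trans (+-cong (scale l a g) (scale m a g)) (sym (distribˡ a _ _))

  *-linear : ∀ {L} b → Linear L → Linear (λ g → b * L g)
  *-linear b l .cong  e   = *-congˡ (cong l e)
  *-linear b l .add   g h = trans (*-congˡ (add l g h)) (distribˡ b _ _)
  *-linear {L} b l .scale a g = trans (*-congˡ (scale l a g))
    (solve 3 (λ b a x → b :* (a :* x) := a :* (b :* x)) refl b a (L g))

  ⟦_⟧ : ℕ → Carrier
  ⟦ zero  ⟧ = 0#
  ⟦ suc n ⟧ = 1# + q * ⟦ n ⟧

  -- The definition splits off the lowest term of the q-integer; this splits off the highest.
  ⟦suc⟧ : ∀ n → ⟦ suc n ⟧ ≈ ⟦ n ⟧ + q ^ n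
  ⟦suc⟧ zero    = solve 1 (λ q → con 1 :+ q :* con 0 := con 0 :+ con 1) refl q
  ⟦suc⟧ (suc n) = trans (+-congˡ (*-congˡ (⟦suc⟧ n)))
    (solve 3 (λ q a p → con 1 :+ q :* (a :+ p) := (con 1 :+ q :* a) :+ q :* p) refl
      q ⟦ n ⟧ (q ^ n))

  T : (ℕ → Carrier) → ℕ → Carrier
  T g K = ⟦ suc K ⟧ * g (suc K) + (y * q) * (⟦ K ⟧ * g K)

  T-cong : ∀ {g h} → (∀ K → g K ≈ h K) → ∀ K → T g K ≈ T h K
  T-cong e K = +-cong (*-congˡ (e (suc K))) (*-congˡ (*-congˡ (e K)))

  -- The q-Euler operator x^K ↦ [K] x^K, acting on test functions. Since [K+1] = 1 + q [K], the
  -- operator T is x + q x D + y q D, and commuting with T reduces to exchanging with D.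
  D : (ℕ → Carrier) → ℕ → Carrier
  D g K = ⟦ K ⟧ * g K

  T-D : ∀ g K → T g K ≈ (g (suc K) + q * D (g ∘ suc) K) + (y * q) * D g K
  T-D g K = solve 5 (λ q y a x w →
      (con 1 :+ q :* a) :* x :+ (y :* q) :* w := (x :+ q :* (a :* x)) :+ (y :* q) :* w)
    refl q y ⟦ K ⟧ (g (suc K)) (D g K)

  linear-T : ∀ {L} → Linear L → ∀ g →
    L (T g) ≈ (L (g ∘ suc) + q * L (D (g ∘ suc))) + (y * q) * L (D g)
  linear-T {L} l g = begin
    L (T g)
      ≈⟨ cong l (T-D g) ⟩
    L (λ K → (g (suc K) + q * D (g ∘ suc) K) + (y * q) * D g K)
      ≈⟨ add l _ _ ⟩
    L (λ K → g (suc K) + q * D (g ∘ suc) K) + L (λ K → (y * q) * D g K)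
      ≈⟨ +-cong (trans (add l _ _) (+-congˡ (scale l _ _))) (scale l _ _) ⟩
    (L (g ∘ suc) + q * L (D (g ∘ suc))) + (y * q) * L (D g) ∎

  -- The effect on x^K of shuffling k copies of a largest letter into K blocks (a block ends at
  -- each position where x is chosen over y).  Reading from the left: place a copy before the
  -- first block, or pass that block with or without having prefixed a copy to it.
  C : ℕ → ℕ → Functional
  C zero    K       g = g K
  C (suc k) zero    g = C k zero (g ∘ suc)
  C (suc k) (suc K) g =
    q ^ suc K * C k (suc K) (g ∘ suc) +
    (C (suc k) K (g ∘ suc) + (y * q ^ suc K) * C k K (g ∘ suc))

  C-linear : ∀ k K → Linear (C k K)
  C-linear zero    K       = eval-linear K
  C-linear (suc k) zero    = suc-linear (C-linear k zero)
  C-linear (suc k) (suc K) =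
    +-linear (*-linear _ (suc-linear (C-linear k (suc K))))
      (+-linear (suc-linear (C-linear (suc k) K))
        (*-linear _ (suc-linear (C-linear k K))))

  C-zero : ∀ k g → C k zero g ≡ g k
  C-zero zero    g = ≡.refl
  C-zero (suc k) g = C-zero k (g ∘ suc)

  -- A copy before the first block contributes q^(K+1), which completes [K+1] to [K+2]; a copy
  -- prefixed to the first block completes [K] to [K+1] in the same way.
  C-one : ∀ K g → C 1 K g ≈ T g K
  C-one zero    g = solve 4 (λ q y a b →
    a := (con 1 :+ q :* con 0) :* a :+ (y :* q) :* (con 0 :* b)) refl q y (g 1) (g 0)
  C-one (suc K) g = begin
    q ^ suc K * g (suc (suc K)) + (C 1 K (g ∘ suc) + (y * q ^ suc K) * g (suc K))
      ≈⟨ +-congˡ (+-congʳ (C-one K (g ∘ suc))) ⟩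
    q ^ suc K * g (suc (suc K)) +
      ((⟦ suc K ⟧ * g (suc (suc K)) + (y * q) * (⟦ K ⟧ * g (suc K)))
       + (y * q ^ suc K) * g (suc K))
      ≈⟨ solve 7 (λ q y p a b u v →
           (q :* p) :* u :+ ((a :* u :+ (y :* q) :* (b :* v)) :+ (y :* (q :* p)) :* v)
           := (a :+ q :* p) :* u :+ (y :* q) :* ((b :+ p) :* v)) refl
           q y (q ^ K) ⟦ suc K ⟧ ⟦ K ⟧ (g (suc (suc K))) (g (suc K)) ⟩
    (⟦ suc K ⟧ + q ^ suc K) * g (suc (suc K)) + (y * q) * ((⟦ K ⟧ + q ^ K) * g (suc K))
      ≈⟨ +-cong (*-congʳ (⟦suc⟧ (suc K))) (*-congˡ (*-congʳ (⟦suc⟧ K))) ⟨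
    T g (suc K) ∎

  Commutes : ℕ → Set (c ⊔ ℓ)
  Commutes k = ∀ K g → C k K (T g) ≈ T (λ J → C k J g) K

  -- The q-Leibniz rule for D and multiplication by x.
  D-suc : ∀ {L} → Linear L → ∀ g →
    L (D g ∘ suc) ≈ L (g ∘ suc) + q * L (D (g ∘ suc))
  D-suc {L} l g = begin
    L (D g ∘ suc)
      ≈⟨ cong l (λ K → solve 3 (λ q a x →
           (con 1 :+ q :* a) :* x := x :+ q :* (a :* x)) refl q ⟦ K ⟧ (g (suc K))) ⟩
    L (λ K → g (suc K) + q * D (g ∘ suc) K)
      ≈⟨ trans (add l _ _) (+-congˡ (scale l _ _)) ⟩
    L (g ∘ suc) + q * L (D (g ∘ suc)) ∎

  -- Exchanging D with C costs only terms with one copy fewer. In the induction on K the terms x₅ +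
  -- q x₄ + y q x₇ assemble by `linear-T` into C k K applied to T, so commutation for k closes the
  -- step. `C-T` at k + 1 in turn calls this lemma with the commutation for k.
  C-D : ∀ k → Commutes k → ∀ K g →
    C (suc k) K (D g) ≈
      q ^ suc K * C k K (D (g ∘ suc)) + (⟦ K ⟧ * C (suc k) K g + q ^ K * C k K (g ∘ suc))
  C-D k comm zero g = begin
    C k 0 (D g ∘ suc)
      ≈⟨ D-suc (C-linear k 0) g ⟩
    C k 0 (g ∘ suc) + q * C k 0 (D (g ∘ suc))
      ≈⟨ solve 3 (λ q a b → a :+ q :* b :=
           (q :* con 1) :* b :+ (con 0 :* a :+ con 1 :* a)) refl
           q (C k 0 (g ∘ suc)) (C k 0 (D (g ∘ suc))) ⟩
    q ^ 1 * C k 0 (D (g ∘ suc)) + (0# * C (suc k) 0 g + 1# * C k 0 (g ∘ suc)) ∎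
  C-D k comm (suc K) g = begin
    Q * C k (suc K) (D g ∘ suc) +
      (C (suc k) K (D g ∘ suc) + (y * Q) * C k K (D g ∘ suc))
      ≈⟨ +-cong (*-congˡ (D-suc (C-linear k (suc K)) g))
           (+-cong (trans (D-suc (C-linear (suc k) K) g) (+-congˡ (*-congˡ (C-D k comm K G))))
                   (*-congˡ (D-suc (C-linear k K) g))) ⟩
    Q * (x₁ + q * x₂) +
      ((x₃ + q * (Q * x₄ + (⟦ K ⟧ * x₃ + q ^ K * x₅))) + (y * Q) * (x₆ + q * x₇))
      ≈⟨ solve 11 (λ q y p a x₁ x₂ x₃ x₄ x₅ x₆ x₇ →
           (q :* p) :* (x₁ :+ q :* x₂) :+
            ((x₃ :+ q :* ((q :* p) :* x₄ :+ (a :* x₃ :+ p :* x₅)))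
              :+ (y :* (q :* p)) :* (x₆ :+ q :* x₇))
           := (q :* (q :* p)) :* x₂ :+
             (((q :* p) :* (((x₅ :+ q :* x₄) :+ (y :* q) :* x₇) :+ y :* x₆)
                :+ (con 1 :+ q :* a) :* x₃) :+ (q :* p) :* x₁)) refl
           q y (q ^ K) ⟦ K ⟧ x₁ x₂ x₃ x₄ x₅ x₆ x₇ ⟩
    q * Q * x₂ + ((Q * (((x₅ + q * x₄) + (y * q) * x₇) + y * x₆)
                + ⟦ suc K ⟧ * x₃) + Q * x₁)
      ≈⟨ +-congˡ (+-congʳ (+-congʳ (*-congˡ (+-congʳ
           (trans (sym (linear-T (C-linear k K) G)) (comm K G)))))) ⟩
    q * Q * x₂ + ((Q * ((⟦ suc K ⟧ * x₁ + (y * q) * (⟦ K ⟧ * x₆)) + y * x₆)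
                + ⟦ suc K ⟧ * x₃) + Q * x₁)
      ≈⟨ solve 8 (λ q y p a x₁ x₂ x₃ x₆ →
           let b = con 1 :+ q :* a ; Q = q :* p in
           (q :* Q) :* x₂ :+ ((Q :* ((b :* x₁ :+ (y :* q) :* (a :* x₆)) :+ y :* x₆)
                :+ b :* x₃) :+ Q :* x₁)
           := (q :* Q) :* x₂ :+
            (b :* (Q :* x₁ :+ (x₃ :+ (y :* Q) :* x₆)) :+ Q :* x₁)) refl
           q y (q ^ K) ⟦ K ⟧ x₁ x₂ x₃ x₆ ⟩
    q * Q * x₂ + (⟦ suc K ⟧ * C (suc k) (suc K) g + Q * x₁) ∎
    where
    Q = q ^ suc K
    G = g ∘ suc
    x₁ = C k (suc K) G
    x₂ = C k (suc K) (D G)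
    x₃ = C (suc k) K G
    x₄ = C k K (D (G ∘ suc))
    x₅ = C k K (G ∘ suc)
    x₆ = C k K G
    x₇ = C k K (D G)

  -- T is written through D, and `C-D` moves D past C. The terms with one copy fewer again recombine
  -- into C k K applied to T, where the induction hypothesis applies.
  C-T : ∀ k → Commutes k
  C-T zero    K g = refl
  C-T (suc k) K g = begin
    C (suc k) K (T g)
      ≈⟨ linear-T (C-linear (suc k) K) g ⟩
    (x₁ + q * C (suc k) K (D G)) + (y * q) * C (suc k) K (D g)
      ≈⟨ +-cong (+-congˡ (*-congˡ (C-D k (C-T k) K G))) (*-congˡ (C-D k (C-T k) K g)) ⟩
    (x₁ + q * (q ^ suc K * x₂ + (⟦ K ⟧ * x₁ + q ^ K * x₃))) +
      (y * q) * (q ^ suc K * x₄ + (⟦ K ⟧ * x₅ + q ^ K * x₆))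
      ≈⟨ solve 10 (λ q y p a x₁ x₂ x₃ x₄ x₅ x₆ →
           (x₁ :+ q :* ((q :* p) :* x₂ :+ (a :* x₁ :+ p :* x₃))) :+
            (y :* q) :* ((q :* p) :* x₄ :+ (a :* x₅ :+ p :* x₆))
           := (q :* p) :* ((x₃ :+ q :* x₂) :+ (y :* q) :* x₄) :+
             (((con 1 :+ q :* a) :* x₁ :+ (y :* q) :* (a :* x₅)) :+ (y :* (q :* p)) :* x₆))
           refl q y (q ^ K) ⟦ K ⟧ x₁ x₂ x₃ x₄ x₅ x₆ ⟩
    q ^ suc K * ((x₃ + q * x₂) + (y * q) * x₄) +
      ((⟦ suc K ⟧ * x₁ + (y * q) * (⟦ K ⟧ * x₅)) + (y * q ^ suc K) * x₆)
      ≈⟨ +-congʳ (*-congˡ (trans (sym (linear-T (C-linear k K) G)) (C-T k K G))) ⟩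
    q ^ suc K * (⟦ suc K ⟧ * x₇ + (y * q) * (⟦ K ⟧ * x₆)) +
      ((⟦ suc K ⟧ * x₁ + (y * q) * (⟦ K ⟧ * x₅)) + (y * q ^ suc K) * x₆)
      ≈⟨ solve 8 (λ q y p a x₁ x₅ x₆ x₇ →
           let b = con 1 :+ q :* a ; Q = q :* p in
           Q :* (b :* x₇ :+ (y :* q) :* (a :* x₆)) :+
            ((b :* x₁ :+ (y :* q) :* (a :* x₅)) :+ (y :* Q) :* x₆)
           := b :* (Q :* x₇ :+ (x₁ :+ (y :* Q) :* x₆)) :+ (y :* q) :* (a :* x₅)) refl
           q y (q ^ K) ⟦ K ⟧ x₁ x₅ x₆ x₇ ⟩
    T (λ J → C (suc k) J g) K ∎
    where
    G = g ∘ suc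
    x₁ = C (suc k) K G
    x₂ = C k K (D (G ∘ suc))
    x₃ = C k K (G ∘ suc)
    x₄ = C k K (D G)
    x₅ = C (suc k) K g
    x₆ = C k K G
    x₇ = C k (suc K) G

  -- The product x^e ∏ (x + y q^(1-i)) under T.

  ^-cancel : ∀ d → q ^ d * q⁻¹ ^ d ≈ 1#
  ^-cancel zero    = *-identityˡ 1#
  ^-cancel (suc d) = begin
    (q * q ^ d) * (q⁻¹ * q⁻¹ ^ d)
      ≈⟨ solve 4 (λ a b c d → (a :* b) :* (c :* d) := (a :* c) :* (b :* d)) refl
           q (q ^ d) q⁻¹ (q⁻¹ ^ d) ⟩
    (q * q⁻¹) * (q ^ d * q⁻¹ ^ d)
      ≈⟨ *-cong q*q⁻¹≈1 (^-cancel d) ⟩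
    1# * 1#
      ≈⟨ *-identityˡ 1# ⟩
    1# ∎

  -- x^e ∏_{i=1}^d (x + y q^{1-i})
  Q : ℕ → ℕ → Functional
  Q zero    e g = g e
  Q (suc d) e g = Q d e (g ∘ suc) + (y * q⁻¹ ^ d) * Q d e g

  Q-linear : ∀ d e → Linear (Q d e)
  Q-linear zero    e = eval-linear e
  Q-linear (suc d) e = +-linear (suc-linear (Q-linear d e)) (*-linear _ (Q-linear d e))

  Q-suc : ∀ d e g → Q d (suc e) g ≡ Q d e (g ∘ suc)
  Q-suc zero    e g = ≡.refl
  Q-suc (suc d) e g =
    ≡.cong₂ (λ a b → a + (y * q⁻¹ ^ d) * b) (Q-suc d e (g ∘ suc)) (Q-suc d e g)

  -- Substituting qx for x shifts the factors x + y q^{1-i} by one, up to the power of q; the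
  -- factor x + y then completes the product again.
  Q-scaled : ∀ d e g →
    Q d e (λ K → q ^ K * (g (suc K) + y * g K)) ≈ q ^ (d +ℕ e) * Q (suc d) e g
  Q-scaled zero    e g = *-congˡ (+-congˡ (*-congʳ (sym (*-identityʳ y))))
  Q-scaled (suc d) e g = begin
    Q d e (λ K → q * q ^ K * (g (suc (suc K)) + y * g (suc K))) +
      (y * i) * Q d e (λ K → q ^ K * (g (suc K) + y * g K))
      ≈⟨ +-congʳ (trans (cong l (λ K → *-assoc q _ _)) (scale l q _)) ⟩
    q * Q d e (λ K → q ^ K * (g (suc (suc K)) + y * g (suc K))) +
      (y * i) * Q d e (λ K → q ^ K * (g (suc K) + y * g K))
      ≈⟨ +-cong (*-congˡ (Q-scaled d e (g ∘ suc))) (*-congˡ (Q-scaled d e g)) ⟩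
    q * (q ^ (d +ℕ e) * Q (suc d) e (g ∘ suc)) + (y * i) * (q ^ (d +ℕ e) * Q (suc d) e g)
      ≈⟨ +-congˡ (trans (sym (*-identityˡ _)) (*-congʳ (sym q*q⁻¹≈1))) ⟩
    q * (q ^ (d +ℕ e) * Q (suc d) e (g ∘ suc)) +
      (q * q⁻¹) * ((y * i) * (q ^ (d +ℕ e) * Q (suc d) e g))
      ≈⟨ solve 7 (λ q j y i p a b →
           q :* (p :* a) :+ (q :* j) :* ((y :* i) :* (p :* b)) :=
           (q :* p) :* (a :+ (y :* (j :* i)) :* b)) refl
           q q⁻¹ y i (q ^ (d +ℕ e)) (Q (suc d) e (g ∘ suc)) (Q (suc d) e g) ⟩
    q ^ suc (d +ℕ e) * Q (suc (suc d)) e g ∎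
    where
    i = q⁻¹ ^ d
    l = Q-linear d e

  -- The algebraic form of inserting a smallest letter: weight [d+1] for keeping d descents, weight
  -- q^(d+1) [e] for creating one more. The induction peels off the last factor of the product; T
  -- fails to commute with multiplication by x only by a q-shifted term, which `Q-scaled` evaluates.
  Q-T : ∀ d e g →
    Q d e (T g) ≈ ⟦ suc d ⟧ * Q d (suc e) g + (q ^ suc d * ⟦ e ⟧) * Q (suc d) e g
  Q-T zero    e g = solve 5 (λ q y a u v →
      (con 1 :+ q :* a) :* u :+ (y :* q) :* (a :* v)
      := (con 1 :+ q :* con 0) :* u :+ ((q :* con 1) :* a) :* (u :+ (y :* con 1) :* v))
    refl q y ⟦ e ⟧ (g (suc e)) (g e)
  Q-T (suc d) e g = begin
    Q d e (T g ∘ suc) + (y * i) * Q d e (T g)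
      ≈⟨ +-congʳ (trans (cong l T-suc) (trans (add l _ _) (+-congˡ (scale l q _)))) ⟩
    (Q d e (T G) + q * Q d e (λ K → q ^ K * (G (suc K) + y * G K)))
      + (y * i) * Q d e (T g)
      ≈⟨ +-cong (+-cong (Q-T d e G) (*-congˡ (Q-scaled d e G))) (*-congˡ (Q-T d e g)) ⟩
    ((⟦ suc d ⟧ * x₁ + (q ^ suc d * ⟦ e ⟧) * x₂) + q * (q ^ (d +ℕ e) * x₂))
      + (y * i) * (⟦ suc d ⟧ * x₃ + (q ^ suc d * ⟦ e ⟧) * x₄)
      ≈⟨ +-congʳ (+-congˡ (*-congˡ (*-congʳ (^-homo-* q d e)))) ⟩
    ((⟦ suc d ⟧ * x₁ + (q ^ suc d * ⟦ e ⟧) * x₂) + q * ((q ^ d * q ^ e) * x₂))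
      + (y * i) * (⟦ suc d ⟧ * x₃ + (q ^ suc d * ⟦ e ⟧) * x₄)
      ≈⟨ solve 11 (λ q y i p r b c x₁ x₂ x₃ x₄ →
           ((b :* x₁ :+ ((q :* p) :* c) :* x₂) :+ q :* ((p :* r) :* x₂))
             :+ (y :* i) :* (b :* x₃ :+ ((q :* p) :* c) :* x₄)
           := (b :* (x₁ :+ (y :* i) :* x₃) :+ (q :* p) :* ((c :+ r) :* x₂))
             :+ (p :* i) :* (((y :* q) :* c) :* x₄)) refl
           q y i (q ^ d) (q ^ e) ⟦ suc d ⟧ ⟦ e ⟧ x₁ x₂ x₃ x₄ ⟩
    (⟦ suc d ⟧ * Q (suc d) (suc e) g + q ^ suc d * ((⟦ e ⟧ + q ^ e) * x₂))
      + (q ^ d * i) * (((y * q) * ⟦ e ⟧) * x₄)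
      -- Both products of powers equal 1; the new one supplies q^(-(d+1)), the power in the next
      -- factor of the product.
      ≈⟨ +-cong (+-congˡ (*-congˡ (*-congʳ (sym (⟦suc⟧ e)))))
           (*-congʳ (trans (^-cancel d) (sym (^-cancel (suc d))))) ⟩
    (⟦ suc d ⟧ * Q (suc d) (suc e) g + q ^ suc d * (⟦ suc e ⟧ * x₂))
      + (q ^ suc d * q⁻¹ ^ suc d) * (((y * q) * ⟦ e ⟧) * x₄)
      ≈⟨ solve 9 (λ q y j p b c w x₂ x₄ →
           (b :* w :+ p :* ((con 1 :+ q :* c) :* x₂)) :+ (p :* j) :* (((y :* q) :* c) :* x₄)
           := (b :* w :+ p :* x₂) :+ ((q :* p) :* c) :* (x₂ :+ (y :* j) :* x₄)) refl
           q y (q⁻¹ ^ suc d) (q ^ suc d) ⟦ suc d ⟧ ⟦ e ⟧ (Q (suc d) (suc e) g) x₂ x₄ ⟩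
    (⟦ suc d ⟧ * Q (suc d) (suc e) g + q ^ suc d * x₂)
      + (q ^ suc (suc d) * ⟦ e ⟧) * Q (suc (suc d)) e g
      ≈⟨ +-congʳ (trans (+-congˡ (*-congˡ (reflexive (≡.sym (Q-suc (suc d) e g)))))
           (trans (sym (distribʳ _ _ _)) (*-congʳ (sym (⟦suc⟧ (suc d)))))) ⟩
    ⟦ suc (suc d) ⟧ * Q (suc d) (suc e) g
      + (q ^ suc (suc d) * ⟦ e ⟧) * Q (suc (suc d)) e g ∎
    where
    i = q⁻¹ ^ d
    l = Q-linear d e
    G = g ∘ suc
    x₁ = Q d (suc e) G
    x₂ = Q (suc d) e G
    x₃ = Q d (suc e) g
    x₄ = Q (suc d) e g
    T-suc : ∀ K → T g (suc K) ≈ T G K + q * (q ^ K * (G (suc K) + y * G K))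
    T-suc K = begin
      ⟦ suc (suc K) ⟧ * g (suc (suc K)) + (y * q) * (⟦ suc K ⟧ * g (suc K))
        ≈⟨ +-cong (*-congʳ (⟦suc⟧ (suc K))) (*-congˡ (*-congʳ (⟦suc⟧ K))) ⟩
      (⟦ suc K ⟧ + q * q ^ K) * g (suc (suc K)) + (y * q) * ((⟦ K ⟧ + q ^ K) * g (suc K))
        ≈⟨ solve 7 (λ q y p a b u v →
             (a :+ q :* p) :* u :+ (y :* q) :* ((b :+ p) :* v)
             := (a :* u :+ (y :* q) :* (b :* v)) :+ q :* (p :* (u :+ y :* v))) refl
             q y (q ^ K) ⟦ suc K ⟧ ⟦ K ⟧ (g (suc (suc K))) (g (suc K)) ⟩
      T G K + q * (q ^ K * (G (suc K) + y * G K)) ∎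

  -- Geometric sums and powers of T.

  sumTo : ℕ → (ℕ → Carrier) → Carrier
  sumTo zero    f = 0#
  sumTo (suc m) f = f 0 + sumTo m (f ∘ suc)

  sumTo-cong : ∀ m {f g} → (∀ i → f i ≈ g i) → sumTo m f ≈ sumTo m g
  sumTo-cong zero    e = refl
  sumTo-cong (suc m) e = +-cong (e 0) (sumTo-cong m (e ∘ suc))

  sumTo-last : ∀ m f → sumTo (suc m) f ≈ sumTo m f + f m
  sumTo-last zero    f = +-comm _ _
  sumTo-last (suc m) f = trans (+-congˡ (sumTo-last m (f ∘ suc))) (sym (+-assoc _ _ _))

  sumTo-geometric : ∀ m s x → sumTo m (λ i → q ^ (s +ℕ i) * x) ≈ (q ^ s * ⟦ m ⟧) * x
  sumTo-geometric zero    s x = solve 2 (λ p x → con 0 := (p :* con 0) :* x) refl (q ^ s) x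
  sumTo-geometric (suc m) s x = begin
    q ^ (s +ℕ 0) * x + sumTo m (λ i → q ^ (s +ℕ suc i) * x)
      ≈⟨ +-cong (*-congʳ (^-congʳ q (+ℕ-identityʳ s)))
           (sumTo-cong m (λ i → *-congʳ (^-congʳ q (+ℕ-suc s i)))) ⟩
    q ^ s * x + sumTo m (λ i → q ^ (suc s +ℕ i) * x)
      ≈⟨ +-congˡ (sumTo-geometric m (suc s) x) ⟩
    q ^ s * x + (q ^ suc s * ⟦ m ⟧) * x
      ≈⟨ solve 4 (λ q p a x → p :* x :+ ((q :* p) :* a) :* x := (p :* (con 1 :+ q :* a)) :* x)
           refl q (q ^ s) ⟦ m ⟧ x ⟩
    (q ^ s * ⟦ suc m ⟧) * x ∎

  T^ : ℕ → (ℕ → Carrier) → ℕ → Carrier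
  T^ zero    g = g
  T^ (suc m) g = T (T^ m g)

  T^-T : ∀ m g → T^ m (T g) ≡ T (T^ m g)
  T^-T zero    g = ≡.refl
  T^-T (suc m) g = ≡.cong T (T^-T m g)

  T^-C : ∀ m k K g → T^ m (λ J → C k J g) K ≈ C k K (T^ m g)
  T^-C zero    k K g = refl
  T^-C (suc m) k K g = trans (T-cong (λ J → T^-C m k J g) K) (sym (C-T k K (T^ m g)))

  -- Sums over shuffles and insertions.

  module _ {X : Set} where

    -- The k inserted copies of a are indistinguishable from each other.
    shuffleΣ : X → ℕ → List X → (List X → Carrier) → Carrier
    shuffleΣ a zero    w       G = G w
    shuffleΣ a (suc k) []      G = shuffleΣ a k [] (G ∘ (a ∷_))
    shuffleΣ a (suc k) (b ∷ w) G =
      shuffleΣ a k (b ∷ w) (G ∘ (a ∷_)) + shuffleΣ a (suc k) w (G ∘ (b ∷_))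

    insertΣ : X → List X → (List X → Carrier) → Carrier
    insertΣ a = shuffleΣ a 1

    -- All the words summed over have the same letters, so facts that depend on the content, such as
    -- bounds on every letter, may be used in each summand.
    shuffleΣ-cong : ∀ a k w {G H} → (∀ v → v ↭ replicate k a ++ w → G v ≈ H v) →
      shuffleΣ a k w G ≈ shuffleΣ a k w H
    shuffleΣ-cong a zero    w       e = e w ↭-refl
    shuffleΣ-cong a (suc k) []      e = shuffleΣ-cong a k [] (λ v p → e (a ∷ v) (prep a p))
    shuffleΣ-cong a (suc k) (b ∷ w) e = +-cong
      (shuffleΣ-cong a k (b ∷ w) (λ v p → e (a ∷ v) (prep a p)))
      (shuffleΣ-cong a (suc k) w (λ v p → e (b ∷ v)
        (↭-trans (prep b p) (↭-sym (shift b (replicate (suc k) a) w)))))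

    shuffleΣ-cong′ : ∀ a k w {G H} → (∀ v → G v ≈ H v) →
      shuffleΣ a k w G ≈ shuffleΣ a k w H
    shuffleΣ-cong′ a k w e = shuffleΣ-cong a k w (λ v _ → e v)

    shuffleΣ-+ : ∀ a k w G H →
      shuffleΣ a k w (λ v → G v + H v) ≈ shuffleΣ a k w G + shuffleΣ a k w H
    shuffleΣ-+ a zero    w       G H = refl
    shuffleΣ-+ a (suc k) []      G H = shuffleΣ-+ a k [] (G ∘ (a ∷_)) (H ∘ (a ∷_))
    shuffleΣ-+ a (suc k) (b ∷ w) G H = trans
      (+-cong (shuffleΣ-+ a k (b ∷ w) _ _) (shuffleΣ-+ a (suc k) w _ _))
      (solve 4 (λ a b c d → (a :+ b) :+ (c :+ d) := (a :+ c) :+ (b :+ d)) refl _ _ _ _)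

    shuffleΣ-* : ∀ a k w x G → shuffleΣ a k w (λ v → x * G v) ≈ x * shuffleΣ a k w G
    shuffleΣ-* a zero    w       x G = refl
    shuffleΣ-* a (suc k) []      x G = shuffleΣ-* a k [] x (G ∘ (a ∷_))
    shuffleΣ-* a (suc k) (b ∷ w) x G = trans
      (+-cong (shuffleΣ-* a k (b ∷ w) x _) (shuffleΣ-* a (suc k) w x _))
      (sym (distribˡ x _ _))

    shuffleΣ-0 : ∀ a k w {G} → (∀ v → G v ≈ 0#) → shuffleΣ a k w G ≈ 0#
    shuffleΣ-0 a k w {G} e = begin
      shuffleΣ a k w G
        ≈⟨ shuffleΣ-cong′ a k w (λ v → trans (e v) (sym (zeroˡ 0#))) ⟩
      shuffleΣ a k w (λ _ → 0# * 0#)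
        ≈⟨ shuffleΣ-* a k w 0# _ ⟩
      0# * shuffleΣ a k w (λ _ → 0#)
        ≈⟨ zeroˡ _ ⟩
      0# ∎

    shuffleΣ-[] : ∀ a k G → shuffleΣ a k [] G ≡ G (replicate k a)
    shuffleΣ-[] a zero    G = ≡.refl
    shuffleΣ-[] a (suc k) G = shuffleΣ-[] a k (G ∘ (a ∷_))

    -- Both sides run once over the shuffles of w, b and k copies of a; sorting them by the first
    -- letter gives the same cases on each side.
    shuffle-insert : ∀ a k b w G →
      shuffleΣ a k w (λ u → insertΣ b u G) ≈ insertΣ b w (λ u → shuffleΣ a k u G)
    shuffle-insert a zero    b w  G = refl
    shuffle-insert a (suc k) b [] G = trans
      (trans (shuffleΣ-+ a k [] _ _) (+-congˡ (shuffle-insert a k b [] (G ∘ (a ∷_)))))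
      (+-comm _ _)
    shuffle-insert a (suc k) b (d ∷ w) G = begin
      shuffleΣ a k (d ∷ w) (λ u → G (b ∷ a ∷ u) + insertΣ b u (G ∘ (a ∷_))) +
        shuffleΣ a (suc k) w (λ u → G (b ∷ d ∷ u) + insertΣ b u (G ∘ (d ∷_)))
        ≈⟨ +-cong (shuffleΣ-+ a k (d ∷ w) _ _) (shuffleΣ-+ a (suc k) w _ _) ⟩
      (x₁ + shuffleΣ a k (d ∷ w) (λ u → insertΣ b u (G ∘ (a ∷_)))) +
        (x₂ + shuffleΣ a (suc k) w (λ u → insertΣ b u (G ∘ (d ∷_))))
        ≈⟨ +-cong (+-congˡ (shuffle-insert a k b (d ∷ w) (G ∘ (a ∷_))))
                  (+-congˡ (shuffle-insert a (suc k) b w (G ∘ (d ∷_)))) ⟩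
      (x₁ + (x₃ + x₄)) + (x₂ + x₅)
        ≈⟨ solve 5 (λ a b c d e →
             (a :+ (c :+ d)) :+ (b :+ e) := (c :+ (a :+ b)) :+ (d :+ e)) refl
             x₁ x₂ x₃ x₄ x₅ ⟩
      (x₃ + (x₁ + x₂)) + (x₄ + x₅)
        ≈⟨ +-congˡ (shuffleΣ-+ b 1 w _ _) ⟨
      insertΣ b (d ∷ w) (λ u → shuffleΣ a (suc k) u G) ∎
      where
      x₁ = shuffleΣ a k (d ∷ w) (λ u → G (b ∷ a ∷ u))
      x₂ = shuffleΣ a (suc k) w (λ u → G (b ∷ d ∷ u))
      x₃ = shuffleΣ a k (b ∷ d ∷ w) (G ∘ (a ∷_))
      x₄ = insertΣ b w (λ u → shuffleΣ a k (d ∷ u) (G ∘ (a ∷_)))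
      x₅ = insertΣ b w (λ u → shuffleΣ a (suc k) u (G ∘ (d ∷_)))

    -- Inserts the head of S first, whereas contentΣ below inserts it last.
    insertAllΣ : List X → List X → (List X → Carrier) → Carrier
    insertAllΣ w []      G = G w
    insertAllΣ w (a ∷ S) G = insertΣ a w (λ u → insertAllΣ u S G)

    shuffle-insertAll : ∀ a k w S G →
      shuffleΣ a k w (λ u → insertAllΣ u S G) ≈ insertAllΣ w S (λ u → shuffleΣ a k u G)
    shuffle-insertAll a k w []      G = refl
    shuffle-insertAll a k w (b ∷ S) G = trans
      (shuffle-insert a k b w _)
      (shuffleΣ-cong′ b 1 w (λ u → shuffle-insertAll a k u S G))

    -- When S is increasing and lies below h, each inserted letter is smaller than all those
    -- present, as the major index side requires.
    contentΣ : X → ℕ → List X → (List X → Carrier) → Carrier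
    contentΣ h k []      G = shuffleΣ h k [] G
    contentΣ h k (a ∷ S) G = contentΣ h k S (λ w → insertΣ a w G)

    contentΣ-cong : ∀ h k S {G H} → (∀ v → v ↭ S ++ replicate k h → G v ≈ H v) →
      contentΣ h k S G ≈ contentΣ h k S H
    contentΣ-cong h k []      e = shuffleΣ-cong h k [] (λ v p →
      e v (↭-trans p (↭-reflexive (List.++-identityʳ _))))
    contentΣ-cong h k (a ∷ S) e = contentΣ-cong h k S (λ v p →
      shuffleΣ-cong a 1 v (λ u r → e u (↭-trans r (prep a p))))

    contentΣ-* : ∀ h k S x G → contentΣ h k S (λ v → x * G v) ≈ x * contentΣ h k S G
    contentΣ-* h k []      x G = shuffleΣ-* h k [] x G
    contentΣ-* h k (a ∷ S) x G = trans
      (contentΣ-cong h k S (λ v _ → shuffleΣ-* a 1 v x G)) (contentΣ-* h k S x _)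

    -- Insertions commute, so the order can be reversed: S from its head onwards, then the copies of
    -- h. This is the order for the inversion side.
    contentΣ-insertAll : ∀ h k S G →
      contentΣ h k S G ≈ insertAllΣ [] S (λ w → shuffleΣ h k w G)
    contentΣ-insertAll h k S G = trans (step S G) (shuffle-insertAll h k [] S G)
      where
      step : ∀ S G → contentΣ h k S G ≈ shuffleΣ h k [] (λ w → insertAllΣ w S G)
      step []      G = refl
      step (a ∷ S) G = trans (step S _) (shuffleΣ-cong′ h k [] (λ w →
        sym (shuffle-insertAll a 1 w S G)))

  -- The inversion side: inserting largest letters.

  module Generating {X : Set} (_≻_ : X → X → Bool) where
    open Words _≻_

    descent : X → List X → Carrier
    descent a w = if descends a w then y else 0#

    -- n x is the number of letters exceeding x that precede the word.
    Φ : (X → ℕ) → List X → Functional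
    Φ n []      g = g 0
    Φ n (a ∷ w) g = q ^ n a * Φ (n ⊕ a) w (g ∘ suc) + descent a w * Φ (n ⊕ a) w g

    Φ-linear : ∀ n w → Linear (Φ n w)
    Φ-linear n []      = eval-linear 0
    Φ-linear n (a ∷ w) = +-linear (*-linear _ (suc-linear (Φ-linear (n ⊕ a) w)))
                                  (*-linear _ (Φ-linear (n ⊕ a) w))

    -- The last letter never descends and so contributes a factor x; hence every exponent of x is
    -- positive.
    Φ-positive : ∀ n a w {g h} → (∀ K → g (suc K) ≈ h (suc K)) →
      Φ n (a ∷ w) g ≈ Φ n (a ∷ w) h
    Φ-positive n a []      e = +-cong (*-congˡ (e 0)) (trans (zeroˡ _) (sym (zeroˡ _)))
    Φ-positive n a (b ∷ w) e = +-cong (*-congˡ (cong (Φ-linear (n ⊕ a) (b ∷ w)) e))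
                                      (*-congˡ (Φ-positive (n ⊕ a) b w e))

    -- n′ counts j copies of the largest letter h in addition to what n counts.
    record Shifted (h : X) (j : ℕ) (n n′ : X → ℕ) : Set where
      field
        at-top : n′ h ≡ 0
        below  : ∀ x → x ≺ h → n′ x ≡ j +ℕ n x

    open Shifted

    if-false-* : ∀ {b} → b ≡ false → ∀ x → (if b then y else 0#) * x ≈ 0#
    if-false-* ≡.refl = zeroˡ

    -- There is no descent from a to a copy of h, so the shuffles that put h directly after a
    -- vanish.
    descent-shuffle : ∀ {a h} → a ≻ h ≡ false → ∀ k b w (F : List X → Carrier) →
      shuffleΣ h k (b ∷ w) (λ v → descent a v * F v) ≈
      descent a (b ∷ w) * shuffleΣ h k w (F ∘ (b ∷_))
    descent-shuffle         a⊁h zero    b w F = refl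
    descent-shuffle {a} {h} a⊁h (suc k) b w F = begin
      shuffleΣ h k (b ∷ w) (λ v → (if a ≻ h then y else 0#) * F (h ∷ v)) +
        shuffleΣ h (suc k) w (λ v → descent a (b ∷ w) * F (b ∷ v))
        ≈⟨ +-cong (shuffleΣ-0 h k (b ∷ w) (λ v → if-false-* a⊁h _))
                  (shuffleΣ-* h (suc k) w _ _) ⟩
      0# + descent a (b ∷ w) * shuffleΣ h (suc k) w (F ∘ (b ∷_))
        ≈⟨ +-identityˡ _ ⟩
      descent a (b ∷ w) * shuffleΣ h (suc k) w (F ∘ (b ∷_)) ∎

    descent-shuffle-[] : ∀ {a h} → a ≻ h ≡ false → ∀ k (F : List X → Carrier) →
      shuffleΣ h k [] (λ v → descent a v * F v) ≈ 0#
    descent-shuffle-[]         a⊁h zero    F = zeroˡ _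
    descent-shuffle-[] {a} {h} a⊁h (suc k) F = shuffleΣ-0 h k [] (λ v → if-false-* a⊁h _)

    module _ (h : X) (h⊁h : h ≻ h ≡ false) where

      shifted-letter : ∀ {j n n′ a} → a ≺ h → Shifted h j n n′ → Shifted h j (n ⊕ a) (n′ ⊕ a)
      shifted-letter (_ , a⊁h) s .at-top rewrite a⊁h = at-top s
      shifted-letter {j} {n} {a = a} _ s .below x x≺h =
        ≡.trans (≡.cong (d +ℕ_) (below s x x≺h))
          (x∙yz≈y∙xz d j (n x))
        where
        d = if a ≻ x then 1 else 0

      shifted-top : ∀ {j n n′} → Shifted h j n n′ → Shifted h (suc j) n (n′ ⊕ h)
      shifted-top s .at-top rewrite h⊁h = at-top s
      shifted-top s .below x (h≻x , x⊁h) rewrite h≻x = ≡.cong suc (below s x (h≻x , x⊁h))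

      -- What C becomes when no copy of h is put before or into the first block.  Φ on a nonempty
      -- word ignores the value at 0.
      C° : ℕ → ℕ → (ℕ → Carrier) → ℕ → Carrier
      C° j k g zero    = 0#
      C° j k g (suc K) = q ^ j * ((q ^ j) ^ K * C k K (g ∘ suc))

      -- With j copies of h already in front, each letter of w at which x is chosen gains q^j, hence
      -- the factor (q^j)^K. The copies of h gain nothing, as no letter exceeds them.
      shuffle-Φ : ∀ {j n n′} → Shifted h j n n′ → ∀ k w → All (_≺ h) w → ∀ g →
        shuffleΣ h k w (λ v → Φ n′ v g) ≈ Φ n w (λ K → (q ^ j) ^ K * C k K g)
      -- If y is chosen at a, then a descends and the next letter must come from w. So no copy of h
      -- can appear before the first x, which is what `C°` encodes.
      cons-shuffle-Φ : ∀ {j n n′} → Shifted h j n n′ → ∀ k a w →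
        All (_≺ h) (a ∷ w) → ∀ g →
        shuffleΣ h k w (λ v → Φ n′ (a ∷ v) g) ≈ Φ n (a ∷ w) (C° j k g)

      cons-Φ-top : ∀ {j n n′} → Shifted h j n n′ → ∀ v g →
        Φ n′ (h ∷ v) g ≈ Φ (n′ ⊕ h) v (g ∘ suc) + descent h v * Φ (n′ ⊕ h) v g
      cons-Φ-top s v g rewrite at-top s = +-congʳ (*-identityˡ _)

      shuffle-Φ s zero    [] _ g = sym (*-identityˡ _)
      shuffle-Φ s (suc k) [] _ g = begin
        shuffleΣ h k [] (λ v → Φ _ (h ∷ v) g)
          ≈⟨ shuffleΣ-cong′ h k [] (λ v → cons-Φ-top s v g) ⟩
        shuffleΣ h k [] (λ v → Φ _ v (g ∘ suc) + descent h v * Φ _ v g)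
          ≈⟨ shuffleΣ-+ h k [] _ _ ⟩
        shuffleΣ h k [] (λ v → Φ _ v (g ∘ suc)) +
          shuffleΣ h k [] (λ v → descent h v * Φ _ v g)
          ≈⟨ +-cong (shuffle-Φ (shifted-top s) k [] [] (g ∘ suc))
                    (descent-shuffle-[] h⊁h k _) ⟩
        1# * C (suc k) 0 g + 0#
          ≈⟨ +-identityʳ _ ⟩
        1# * C (suc k) 0 g ∎
      shuffle-Φ {n = n} s zero (b ∷ w) w≺h g =
        trans (cons-shuffle-Φ s zero b w w≺h g)
          (Φ-positive n b w (λ K → sym (*-assoc _ _ _)))
      shuffle-Φ {j} {n} {n′} s (suc k) (b ∷ w) w≺h g = begin
        shuffleΣ h k (b ∷ w) (λ v → Φ n′ (h ∷ v) g) +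
          shuffleΣ h (suc k) w (λ v → Φ n′ (b ∷ v) g)
          ≈⟨ +-congʳ (trans (shuffleΣ-cong′ h k (b ∷ w) (λ v → cons-Φ-top s v g))
               (trans (shuffleΣ-+ h k (b ∷ w) _ _)
                 (+-cong (shuffle-Φ s′ k (b ∷ w) w≺h (g ∘ suc))
                   (descent-shuffle h⊁h k b w _)))) ⟩
        (Φ n (b ∷ w) (λ K → (q ^ suc j) ^ K * C k K (g ∘ suc)) +
          descent h (b ∷ w) * shuffleΣ h k w (λ v → Φ (n′ ⊕ h) (b ∷ v) g)) +
          shuffleΣ h (suc k) w (λ v → Φ n′ (b ∷ v) g)
          ≈⟨ +-cong (+-congˡ (*-cong
                (reflexive (≡.cong (if_then y else 0#) (proj₁ (All.head w≺h))))
                (cons-shuffle-Φ s′ k b w w≺h g))) (cons-shuffle-Φ s (suc k) b w w≺h g) ⟩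
        (Φ n (b ∷ w) (λ K → (q ^ suc j) ^ K * C k K (g ∘ suc)) +
          y * Φ n (b ∷ w) (C° (suc j) k g)) + Φ n (b ∷ w) (C° j (suc k) g)
          ≈⟨ +-congʳ (+-congˡ (scale l y _)) ⟨
        (Φ n (b ∷ w) (λ K → (q ^ suc j) ^ K * C k K (g ∘ suc)) +
          Φ n (b ∷ w) (λ K → y * C° (suc j) k g K)) + Φ n (b ∷ w) (C° j (suc k) g)
          ≈⟨ trans (add l _ _) (+-congʳ (add l _ _)) ⟨
        Φ n (b ∷ w) (λ K → ((q ^ suc j) ^ K * C k K (g ∘ suc) + y * C° (suc j) k g K)
                           + C° j (suc k) g K)
          -- The summands are: h in front with x chosen, h in front with y chosen, b in front. They
          -- match the three terms of C; the additional h supplies q^(K+1), one q for each x of the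
          -- original word.
          ≈⟨ Φ-positive n b w merge ⟩
        Φ n (b ∷ w) (λ K → (q ^ j) ^ K * C (suc k) K g) ∎
        where
        l = Φ-linear n (b ∷ w)
        s′ = shifted-top s
        merge : ∀ K →
          ((q ^ suc j) ^ suc K * C k (suc K) (g ∘ suc) + y * C° (suc j) k g (suc K))
            + C° j (suc k) g (suc K) ≈ (q ^ j) ^ suc K * C (suc k) (suc K) g
        merge K = begin
          ((q ^ suc j) ^ suc K * x₁ + y * (q ^ suc j * ((q ^ suc j) ^ K * x₂)))
            + q ^ j * ((q ^ j) ^ K * x₃)
            ≈⟨ +-congʳ (+-cong (*-congʳ (^-distrib-* q (q ^ j) (suc K)))
                 (*-congˡ (*-congˡ (*-congʳ (^-distrib-* q (q ^ j) K))))) ⟩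
          ((q ^ suc K * (q ^ j) ^ suc K) * x₁ + y * (q ^ suc j * ((q ^ K * (q ^ j) ^ K) * x₂)))
            + q ^ j * ((q ^ j) ^ K * x₃)
            ≈⟨ solve 8 (λ q y p i r x₁ x₂ x₃ →
                 (((q :* p) :* (i :* r)) :* x₁ :+ y :* ((q :* i) :* ((p :* r) :* x₂)))
                   :+ i :* (r :* x₃)
                 := (i :* r) :* ((q :* p) :* x₁ :+ (x₃ :+ (y :* (q :* p)) :* x₂))) refl
                 q y (q ^ K) (q ^ j) ((q ^ j) ^ K) x₁ x₂ x₃ ⟩
          (q ^ j) ^ suc K * C (suc k) (suc K) g ∎
          where
          x₁ = C k (suc K) (g ∘ suc)
          x₂ = C k K (g ∘ suc)
          x₃ = C (suc k) K (g ∘ suc)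

      cons-shuffle-Φ {j} {n} {n′} s k a w (a≺h ∷ w≺h) g = begin
        shuffleΣ h k w (λ v →
          q ^ n′ a * Φ (n′ ⊕ a) v (g ∘ suc) + descent a v * Φ (n′ ⊕ a) v g)
          ≈⟨ trans (shuffleΣ-+ h k w _ _) (+-congʳ (shuffleΣ-* h k w _ _)) ⟩
        q ^ n′ a * shuffleΣ h k w (λ v → Φ (n′ ⊕ a) v (g ∘ suc)) +
          shuffleΣ h k w (λ v → descent a v * Φ (n′ ⊕ a) v g)
          ≈⟨ +-cong (*-cong (trans (^-congʳ q (below s a a≺h)) (^-homo-* q j (n a)))
               (shuffle-Φ s′ k w w≺h (g ∘ suc))) (descending w w≺h) ⟩
        (q ^ j * q ^ n a) * Φ (n ⊕ a) w (λ K → (q ^ j) ^ K * C k K (g ∘ suc)) +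
          descent a w * Φ (n ⊕ a) w (C° j k g)
          ≈⟨ +-congʳ (trans (solve 3 (λ a b c → (a :* b) :* c := b :* (a :* c)) refl _ _ _)
               (*-congˡ (sym (scale (Φ-linear (n ⊕ a) w) _ _)))) ⟩
        Φ n (a ∷ w) (C° j k g) ∎
        where
        s′ = shifted-letter a≺h s
        descending : ∀ w → All (_≺ h) w →
          shuffleΣ h k w (λ v → descent a v * Φ (n′ ⊕ a) v g) ≈
          descent a w * Φ (n ⊕ a) w (C° j k g)
        descending []      _   = trans (descent-shuffle-[] (proj₂ a≺h) k _) (sym (zeroˡ _))
        descending (b ∷ w) w≺h = trans (descent-shuffle (proj₂ a≺h) k b w _)
          (*-congˡ (cons-shuffle-Φ s′ k b w w≺h g))

      shuffle-Φ₀ : ∀ k w → All (_≺ h) w → ∀ g →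
        shuffleΣ h k w (λ v → Φ (λ _ → 0) v g) ≈ Φ (λ _ → 0) w (λ K → C k K g)
      shuffle-Φ₀ k w w≺h g = trans
        (shuffle-Φ (record { at-top = ≡.refl ; below = λ _ _ → ≡.refl }) k w w≺h g)
        (cong (Φ-linear _ w) (λ K → trans (*-congʳ (1^ K)) (*-identityˡ _)))
        where
        1^ : ∀ K → 1# ^ K ≈ 1#
        1^ zero    = refl
        1^ (suc K) = trans (*-identityˡ _) (1^ K)

    insert-Φ : ∀ a → a ≻ a ≡ false → ∀ w → All (_≺ a) w → ∀ g →
      insertΣ a w (λ v → Φ (λ _ → 0) v g) ≈ Φ (λ _ → 0) w (T g)
    insert-Φ a a⊁a w w≺a g = trans (shuffle-Φ₀ a a⊁a 1 w w≺a g)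
      (cong (Φ-linear _ w) (λ K → C-one K g))

    insertAll-Φ : (∀ a → a ≻ a ≡ false) → ∀ S w →
      AllPairs _≺_ S → All (λ a → All (_≺ a) w) S → ∀ g →
      insertAllΣ w S (λ v → Φ (λ _ → 0) v g) ≈ Φ (λ _ → 0) w (T^ (length S) g)
    insertAll-Φ irr []      w _         _           g = refl
    insertAll-Φ irr (a ∷ S) w (a≺S ∷ S↗) (w≺a ∷ w≺S) g = trans
      (shuffleΣ-cong a 1 w (λ v v↭ → insertAll-Φ irr S v S↗
        (All.zipWith (λ (a≺b , w≺b) → All-resp-↭ (↭-sym v↭) (a≺b ∷ w≺b)) (a≺S , w≺S)) g))
      (insert-Φ a (irr a) w w≺a _)

    content-Φ : (∀ a → a ≻ a ≡ false) → ∀ h k S →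
      AllPairs _≺_ S → All (_≺ h) S → ∀ g →
      contentΣ h k S (λ v → Φ (λ _ → 0) v g) ≈ T^ (length S) g k
    content-Φ irr h k S S↗ S≺h g = begin
      contentΣ h k S (λ v → Φ (λ _ → 0) v g)
        ≈⟨ contentΣ-insertAll h k S _ ⟩
      insertAllΣ [] S (λ w → shuffleΣ h k w (λ v → Φ (λ _ → 0) v g))
        ≈⟨ insertAll-shuffle S [] S≺h [] ⟩
      insertAllΣ [] S (λ w → Φ (λ _ → 0) w (λ K → C k K g))
        ≈⟨ insertAll-Φ irr S [] S↗ (All.universal (λ _ → []) S) _ ⟩
      -- On test functions the order is reversed: the C next to g is the operator applied last to
      -- the polynomial.
      T^ (length S) (λ K → C k K g) 0
        ≈⟨ T^-C (length S) k 0 g ⟩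
      C k 0 (T^ (length S) g)
        ≡⟨ C-zero k _ ⟩
      T^ (length S) g k ∎
      where
      insertAll-shuffle : ∀ S w → All (_≺ h) S → All (_≺ h) w →
        insertAllΣ w S (λ w → shuffleΣ h k w (λ v → Φ (λ _ → 0) v g)) ≈
        insertAllΣ w S (λ w → Φ (λ _ → 0) w (λ K → C k K g))
      insertAll-shuffle []      w _            w≺h = shuffle-Φ₀ h (irr h) k w w≺h g
      insertAll-shuffle (a ∷ S) w (a≺h ∷ S≺h) w≺h = shuffleΣ-cong a 1 w (λ v v↭ →
        insertAll-shuffle S v S≺h (All-resp-↭ (↭-sym v↭) (a≺h ∷ w≺h)))

    -- The major index side: inserting smallest letters.

    statistics : (ℕ → ℕ → ℕ → Carrier) → List X → Carrier
    statistics f w = f (descents w) (ascents w) (major w)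

    -- Carlitz: inserting a smallest letter into a word with d descents, anywhere but in front of
    -- its first letter, keeps d for the major index increments 0, …, d-1 and raises it for the
    -- remaining increments d+1, …, d+e.
    insert-statistics : ∀ a b w → All (a ≺_) (b ∷ w) → ∀ f →
      let d = descents (b ∷ w) ; e = ascents (b ∷ w) ; m = major (b ∷ w) in
      insertΣ a w (λ v → statistics f (b ∷ v)) ≈
        sumTo d (λ i → f d (suc e) (m +ℕ i)) +
        sumTo e (λ i → f (suc d) e (m +ℕ suc (d +ℕ i)))
    insert-statistics a b [] ((b≻a , _) ∷ []) f rewrite b≻a =
      sym (trans (+-identityˡ _) (+-identityʳ _))
    insert-statistics a b (c ∷ w) ((b≻a , _) ∷ a≺@((_ , a⊁c) ∷ _)) f
      rewrite b≻a | a⊁c with b ≻ c | insert-statistics a c w a≺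
        (λ d e m → f ((if b ≻ c then 1 else 0) +ℕ d) ((if b ≻ c then 0 else 1) +ℕ e)
                     (((if b ≻ c then 1 else 0) +ℕ d) +ℕ m))
    ... | false | ih = begin
      f (suc d) (suc e) (suc d +ℕ (d +ℕ m)) + _
        ≈⟨ +-congˡ ih ⟩
      f (suc d) (suc e) (suc d +ℕ (d +ℕ m)) +
        (sumTo d (λ i → f d (suc (suc e)) (d +ℕ (m +ℕ i))) +
         sumTo e (λ i → f (suc d) (suc e) (suc d +ℕ (m +ℕ suc (d +ℕ i)))))
        -- Between b and c the letter a creates a descent with increment d + 1: the term i = 0 of
        -- the second sum.
        ≈⟨ trans (sym (+-assoc _ _ _)) (trans (+-congʳ (+-comm _ _)) (+-assoc _ _ _)) ⟩
      sumTo d (λ i → f d (suc (suc e)) (d +ℕ (m +ℕ i))) +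
        (f (suc d) (suc e) (suc d +ℕ (d +ℕ m)) +
         sumTo e (λ i → f (suc d) (suc e) (suc d +ℕ (m +ℕ suc (d +ℕ i)))))
        ≈⟨ +-cong (sumTo-cong d (λ i → reflexive (≡.cong (f _ _) (≡.sym (+ℕ-assoc d m i)))))
             (+-cong
               (reflexive (≡.cong (f _ _) (≡.trans (≡.cong (λ x → suc (d +ℕ x)) (+ℕ-comm d m))
                 (≡.trans (suc-+ℕ-assoc d m d)
                   (≡.cong (λ x → (d +ℕ m) +ℕ suc x) (≡.sym (+ℕ-identityʳ d)))))))
               (sumTo-cong e (λ i → reflexive (≡.cong (f _ _)
                 (≡.trans (suc-+ℕ-assoc d m (suc (d +ℕ i)))
                   (≡.cong (λ x → (d +ℕ m) +ℕ suc x) (≡.sym (+ℕ-suc d i)))))))) ⟩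
      _ ∎
      where
      d = descents (c ∷ w)
      e = ascents (c ∷ w)
      m = major (c ∷ w)
    ... | true | ih = begin
      f (suc d) (suc e) (suc d +ℕ (d +ℕ m)) + _
        ≈⟨ +-congˡ ih ⟩
      f (suc d) (suc e) (suc d +ℕ (d +ℕ m)) +
        (sumTo d (λ i → f (suc d) (suc e) (suc d +ℕ (m +ℕ i))) +
         sumTo e (λ i → f (suc (suc d)) e (suc (suc d) +ℕ (m +ℕ suc (d +ℕ i)))))
        -- Here b already descends, so a between b and c only shifts the d later descents: the last
        -- term, i = d, of the first sum.
        ≈⟨ trans (sym (+-assoc _ _ _)) (+-congʳ (+-comm _ _)) ⟩
      (sumTo d (λ i → f (suc d) (suc e) (suc d +ℕ (m +ℕ i))) +
        f (suc d) (suc e) (suc d +ℕ (d +ℕ m))) +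
         sumTo e (λ i → f (suc (suc d)) e (suc (suc d) +ℕ (m +ℕ suc (d +ℕ i))))
        ≈⟨ +-cong (trans (+-cong
               (sumTo-cong d (λ i → reflexive (≡.cong (f _ _) (≡.sym (+ℕ-assoc (suc d) m i)))))
               (reflexive (≡.cong (f _ _) (≡.cong suc (+ℕ-comm d (d +ℕ m))))))
               (sym (sumTo-last d _)))
             (sumTo-cong e (λ i → reflexive (≡.cong (f _ _)
               (suc-+ℕ-assoc (suc d) m (suc (d +ℕ i)))))) ⟩
      _ ∎
      where
      d = descents (c ∷ w)
      e = ascents (c ∷ w)
      m = major (c ∷ w)

    weight : (ℕ → Carrier) → ℕ → ℕ → ℕ → Carrier
    weight g d e m = q ^ m * Q d e g

    Ψ : List X → Functional
    Ψ w g = statistics (weight g) w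

    -- In front of the first letter, a shifts all d descents and creates none. This fills the
    -- missing increment d, so the increments are 0, ..., d and d+1, ..., d+e. Their geometric sums
    -- are the two coefficients in `Q-T`.
    insert-Ψ : ∀ a w → All (a ≺_) w → ∀ g → insertΣ a w (λ v → Ψ v g) ≈ Ψ w (T g)
    insert-Ψ a []      _ g = *-congˡ (solve 4 (λ q y a b →
        a := (con 1 :+ q :* con 0) :* a :+ (y :* q) :* (con 0 :* b)) refl q y (g 1) (g 0))
    insert-Ψ a (b ∷ w) a≺@((b≻a , a⊁b) ∷ _) g = begin
      Ψ (a ∷ b ∷ w) g + insertΣ a w (λ v → Ψ (b ∷ v) g)
        ≈⟨ +-cong first (insert-statistics a b w a≺ (weight g)) ⟩
      q ^ (m +ℕ d) * x₁ +
        (sumTo d (λ i → q ^ (m +ℕ i) * x₁) +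
         sumTo e (λ i → q ^ (m +ℕ suc (d +ℕ i)) * x₂))
        ≈⟨ trans (sym (+-assoc _ _ _)) (+-congʳ (trans (+-comm _ _)
             (sym (sumTo-last d (λ i → q ^ (m +ℕ i) * x₁))))) ⟩
      sumTo (suc d) (λ i → q ^ (m +ℕ i) * x₁) +
        sumTo e (λ i → q ^ (m +ℕ suc (d +ℕ i)) * x₂)
        ≈⟨ +-cong (sumTo-geometric (suc d) m x₁)
             (trans (sumTo-cong e (λ i → *-congʳ (^-congʳ q (≡.sym (+ℕ-assoc m (suc d) i)))))
               (sumTo-geometric e (m +ℕ suc d) x₂)) ⟩
      (q ^ m * ⟦ suc d ⟧) * x₁ + (q ^ (m +ℕ suc d) * ⟦ e ⟧) * x₂
        ≈⟨ +-congˡ (*-congʳ (*-congʳ (^-homo-* q m (suc d)))) ⟩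
      (q ^ m * ⟦ suc d ⟧) * x₁ + ((q ^ m * q ^ suc d) * ⟦ e ⟧) * x₂
        ≈⟨ solve 6 (λ p b r c x₁ x₂ → (p :* b) :* x₁ :+ ((p :* r) :* c) :* x₂
              := p :* (b :* x₁ :+ (r :* c) :* x₂)) refl
              (q ^ m) ⟦ suc d ⟧ (q ^ suc d) ⟦ e ⟧ x₁ x₂ ⟩
      q ^ m * (⟦ suc d ⟧ * x₁ + (q ^ suc d * ⟦ e ⟧) * x₂)
        ≈⟨ *-congˡ (Q-T d e g) ⟨
      Ψ (b ∷ w) (T g) ∎
      where
      d = descents (b ∷ w)
      e = ascents (b ∷ w)
      m = major (b ∷ w)
      x₁ = Q d (suc e) g
      x₂ = Q (suc d) e g
      first : Ψ (a ∷ b ∷ w) g ≈ q ^ (m +ℕ d) * x₁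
      first rewrite a⊁b = *-congʳ (^-congʳ q (+ℕ-comm d m))

    statistics-tie : ∀ h → h ≻ h ≡ false → ∀ w f →
      statistics f (h ∷ h ∷ w) ≡ statistics (λ d e m → f d (suc e) (d +ℕ m)) (h ∷ w)
    statistics-tie h h⊁h w f rewrite h⊁h = ≡.refl

    statistics-replicate : ∀ h → h ≻ h ≡ false → ∀ k f → statistics f (replicate k h) ≡ f 0 k 0
    statistics-replicate h h⊁h zero          f = ≡.refl
    statistics-replicate h h⊁h (suc zero)    f = ≡.refl
    statistics-replicate h h⊁h (suc (suc k)) f =
      ≡.trans (statistics-tie h h⊁h (replicate k h) f)
        (statistics-replicate h h⊁h (suc k) (λ d e m → f d (suc e) (d +ℕ m)))

    Ψ-replicate : ∀ h → h ≻ h ≡ false → ∀ k g → Ψ (replicate k h) g ≈ g k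
    Ψ-replicate h h⊁h k g =
      trans (reflexive (statistics-replicate h h⊁h k (weight g))) (*-identityˡ _)

    content-Ψ : ∀ h → h ≻ h ≡ false → ∀ k S →
      AllPairs _≺_ S → All (_≺ h) S → ∀ g →
      contentΣ h k S (λ v → Ψ v g) ≈ T^ (length S) g k
    content-Ψ h h⊁h k [] _ _ g =
      trans (reflexive (shuffleΣ-[] h k _)) (Ψ-replicate h h⊁h k g)
    content-Ψ h h⊁h k (a ∷ S) (a≺S ∷ S↗) (a≺h ∷ S≺h) g = begin
      contentΣ h k S (λ w → insertΣ a w (λ v → Ψ v g))
        ≈⟨ contentΣ-cong h k S (λ w w↭ → insert-Ψ a w
             (All-resp-↭ (↭-sym w↭) (All.++⁺ a≺S (All.replicate⁺ k a≺h))) g) ⟩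
      contentΣ h k S (λ w → Ψ w (T g))
        ≈⟨ content-Ψ h h⊁h k S S↗ S≺h (T g) ⟩
      T^ (length S) (T g) k
        ≡⟨ ≡.cong (λ f → f k) (T^-T (length S) g) ⟩
      T^ (suc (length S)) g k ∎

-- Laguerre words again: finite sums over lists.

module Equidistribution {c ℓ} (R : CommutativeRing c ℓ) (q q⁻¹ z : CommutativeRing.Carrier R)
  (q*q⁻¹≈1 : CommutativeRing._≈_ R (CommutativeRing._*_ R q q⁻¹) (CommutativeRing.1# R))
  (n k : ℕ) where

  open CommutativeRing R hiding (zero)

  y : Carrier
  y = z * q⁻¹

  open Insertion R q q⁻¹ y q*q⁻¹≈1
  open Words (_>ᴸ_ {n}) using (_⊕_; descends; descents; ascents; major)
  open Generating (_>ᴸ_ {n})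
  open Gen R using (Σ[_]; Π[_]; LHS; RHS)
  open import Algebra.Definitions.RawSemiring (Semiring.rawSemiring semiring) using (_^_)
  open import Algebra.Properties.Semiring.Exp semiring using (^-homo-*; ^-congʳ)
  open import Algebra.Solver.Ring.NaturalCoefficients.Default commutativeSemiring
    using (solve; _:=_; _:+_; _:*_; con)
  open import Relation.Binary.Reasoning.Setoid setoid

  ∑ : ∀ {a} {A : Set a} → List A → (A → Carrier) → Carrier
  ∑ xs f = Σ[ map f xs ]

  module _ {A : Set} where

    ∑-cong : ∀ {xs : List A} {f g} → All (λ x → f x ≈ g x) xs → ∑ xs f ≈ ∑ xs g
    ∑-cong []       = refl
    ∑-cong (e ∷ es) = +-cong e (∑-cong es)

    ∑-cong′ : ∀ (xs : List A) {f g} → (∀ x → f x ≈ g x) → ∑ xs f ≈ ∑ xs g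
    ∑-cong′ xs e = ∑-cong (All.universal e xs)

    ∑-+ : ∀ (xs : List A) f g → ∑ xs (λ x → f x + g x) ≈ ∑ xs f + ∑ xs g
    ∑-+ []       f g = sym (+-identityˡ 0#)
    ∑-+ (x ∷ xs) f g = trans (+-congˡ (∑-+ xs f g))
      (solve 4 (λ a b c d → (a :+ b) :+ (c :+ d) := (a :+ c) :+ (b :+ d)) refl _ _ _ _)

    ∑-0 : ∀ (xs : List A) → ∑ xs (λ _ → 0#) ≈ 0#
    ∑-0 []       = refl
    ∑-0 (x ∷ xs) = trans (+-identityˡ _) (∑-0 xs)

    ∑-++ : ∀ (xs ys : List A) f → ∑ (xs ++ ys) f ≈ ∑ xs f + ∑ ys f
    ∑-++ []       ys f = sym (+-identityˡ _)
    ∑-++ (x ∷ xs) ys f = trans (+-congˡ (∑-++ xs ys f)) (sym (+-assoc _ _ _))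

  ∑-map : ∀ {A B : Set} (h : A → B) xs f → ∑ (map h xs) f ≡ ∑ xs (f ∘ h)
  ∑-map h xs f = ≡.cong Σ[_] (≡.sym (List.map-∘ xs))

  ∑-concatMap : ∀ {A B : Set} (h : A → List B) xs f →
    ∑ (concatMap h xs) f ≈ ∑ xs (λ x → ∑ (h x) f)
  ∑-concatMap h []       f = refl
  ∑-concatMap h (x ∷ xs) f = trans (∑-++ (h x) _ f) (+-congˡ (∑-concatMap h xs f))

  ∑-filterᵇ : ∀ {A : Set} (p : A → Bool) f xs →
    ∑ (filterᵇ p xs) f ≈ ∑ xs (λ x → if p x then f x else 0#)
  ∑-filterᵇ p f []       = refl
  ∑-filterᵇ p f (x ∷ xs) with p x
  ... | true  = +-congˡ (∑-filterᵇ p f xs)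
  ... | false = trans (∑-filterᵇ p f xs) (sym (+-identityˡ _))

  -- Words with distinct numerals, sorted by content.

  avoid : Fin n → (List (Letter n) → Carrier) → List (Letter n) → Carrier
  avoid a G w = if occurs w a then 0# else G w

  -- The sum of G over the words of length N whose letters are holes and numerals from A, no
  -- numeral occurring twice.
  distinctΣ : List (Fin n) → ℕ → (List (Letter n) → Carrier) → Carrier
  distinctΣ A zero    G = G []
  distinctΣ A (suc N) G = distinctΣ A N (G ∘ (nothing ∷_)) +
    ∑ A (λ a → distinctΣ A N (avoid a (G ∘ (just a ∷_))))

  avoid-cong : ∀ a {G H} → (∀ w → G w ≈ H w) → ∀ w → avoid a G w ≈ avoid a H w
  avoid-cong a e w with occurs w a
  ... | true  = refl
  ... | false = e w

  avoid-+ : ∀ a G H w → avoid a (λ w → G w + H w) w ≈ avoid a G w + avoid a H w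
  avoid-+ a G H w with occurs w a
  ... | true  = sym (+-identityˡ 0#)
  ... | false = refl

  avoid-swap : ∀ a b G w → avoid a (avoid b G) w ≈ avoid b (avoid a G) w
  avoid-swap a b G w with occurs w a | occurs w b
  ... | true  | true  = refl
  ... | true  | false = refl
  ... | false | true  = refl
  ... | false | false = refl

  distinctΣ-cong : ∀ A N {G H} → (∀ w → G w ≈ H w) → distinctΣ A N G ≈ distinctΣ A N H
  distinctΣ-cong A zero    e = e []
  distinctΣ-cong A (suc N) e = +-cong (distinctΣ-cong A N (λ w → e (nothing ∷ w)))
    (∑-cong′ A (λ a → distinctΣ-cong A N (avoid-cong a (λ w → e (just a ∷ w)))))

  distinctΣ-+ : ∀ A N G H →
    distinctΣ A N (λ w → G w + H w) ≈ distinctΣ A N G + distinctΣ A N H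
  distinctΣ-+ A zero    G H = refl
  distinctΣ-+ A (suc N) G H = trans
    (+-cong (distinctΣ-+ A N _ _)
      (trans (∑-cong′ A (λ a → trans
        (distinctΣ-cong A N (avoid-+ a (G ∘ (just a ∷_)) (H ∘ (just a ∷_))))
        (distinctΣ-+ A N _ _)))
        (∑-+ A _ _)))
    (solve 4 (λ a b c d → (a :+ b) :+ (c :+ d) := (a :+ c) :+ (b :+ d)) refl _ _ _ _)

  distinctΣ-0 : ∀ A N {G} → (∀ w → G w ≈ 0#) → distinctΣ A N G ≈ 0#
  distinctΣ-0 A zero    e = e []
  distinctΣ-0 A (suc N) {G} e = trans
    (+-cong (distinctΣ-0 A N (λ w → e (nothing ∷ w)))
      (trans (∑-cong′ A (λ a → distinctΣ-0 A N (vanish a))) (∑-0 A)))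
    (+-identityˡ 0#)
    where
    vanish : ∀ a w → avoid a (G ∘ (just a ∷_)) w ≈ 0#
    vanish a w with occurs w a
    ... | true  = refl
    ... | false = e (just a ∷ w)

  -- Avoiding a removes exactly the words that use the additional numeral.
  distinctΣ-avoid : ∀ a A → All (Apart a) A → ∀ N G →
    distinctΣ (a ∷ A) N (avoid a G) ≈ distinctΣ A N G
  distinctΣ-avoid a A a#A zero    G = refl
  distinctΣ-avoid a A a#A (suc N) G = +-cong
    (distinctΣ-avoid a A a#A N (G ∘ (nothing ∷_)))
    (trans (+-cong (distinctΣ-0 (a ∷ A) N repeated)
        (∑-cong (All.map (λ {b} a#b → trans (distinctΣ-cong (a ∷ A) N (other b a#b))
           (distinctΣ-avoid a A a#A N (avoid b (G ∘ (just b ∷_))))) a#A)))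
      (+-identityˡ _))
    where
    repeated : ∀ w → avoid a (avoid a G ∘ (just a ∷_)) w ≈ 0#
    repeated w rewrite ≡ᶠ-refl a with occurs w a
    ... | true  = refl
    ... | false = refl
    other : ∀ b → Apart a b → ∀ w →
      avoid b (avoid a G ∘ (just b ∷_)) w ≈ avoid a (avoid b (G ∘ (just b ∷_))) w
    other b (a#b , _) w rewrite a#b = avoid-swap b a (G ∘ (just b ∷_)) w

  -- Inserting a different numeral does not affect whether b occurs.
  insert-avoid : ∀ a b → Apart a b → ∀ G w →
    insertΣ (just a) w (avoid b G) ≈ avoid b (λ w → insertΣ (just a) w G) w
  insert-avoid a b (_ , b#a) G w = trans
    (shuffleΣ-cong (just a) 1 w {H = λ v → if occurs w b then 0# else G v} (λ v v↭ →
      reflexive (≡.cong (if_then 0# else G v) (≡.trans (occurs-↭ v↭ b) unaffected))))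
    (constant (occurs w b))
    where
    unaffected : occurs (just a ∷ w) b ≡ occurs w b
    unaffected rewrite b#a = ≡.refl
    constant : ∀ c → insertΣ (just a) w (λ v → if c then 0# else G v)
      ≈ (if c then 0# else insertΣ (just a) w G)
    constant true  = shuffleΣ-0 (just a) 1 w (λ _ → refl)
    constant false = refl

  -- A word with distinct numerals either omits a or arises exactly once by inserting a into a word
  -- over A that is one letter shorter.
  distinctΣ-peel : ∀ a A → All (Apart a) A → ∀ N G →
    distinctΣ (a ∷ A) (suc N) G ≈
    distinctΣ A (suc N) G + distinctΣ A N (λ w → insertΣ (just a) w G)
  distinctΣ-peel a A a#A zero G = solve 3 (λ a b c → a :+ (b :+ c) := (a :+ c) :+ b) refl _ _ _
  distinctΣ-peel a A a#A (suc N) G = begin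
    distinctΣ (a ∷ A) (suc N) (G ∘ (nothing ∷_)) +
      (distinctΣ (a ∷ A) (suc N) (avoid a (G ∘ (just a ∷_))) +
       ∑ A (λ b → distinctΣ (a ∷ A) (suc N) (avoid b (G ∘ (just b ∷_)))))
      ≈⟨ +-cong (distinctΣ-peel a A a#A N _) (+-cong
          (distinctΣ-avoid a A a#A (suc N) (G ∘ (just a ∷_)))
          (trans (∑-cong (All.map (λ {b} a#b → trans (distinctΣ-peel a A a#A N _)
              (+-congˡ (distinctΣ-cong A N (insert-avoid a b a#b (G ∘ (just b ∷_)))))) a#A))
            (∑-+ A _ _))) ⟩
    (x₁ + x₂) + (x₃ + (x₄ + x₅))
      ≈⟨ solve 5 (λ a b c d e → (a :+ b) :+ (c :+ (d :+ e)) := (a :+ d) :+ (c :+ (b :+ e)))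
           refl x₁ x₂ x₃ x₄ x₅ ⟩
    (x₁ + x₄) + (x₃ + (x₂ + x₅))
      ≈⟨ +-congˡ (trans (+-cong
           (distinctΣ-+ A N (λ w → G (just a ∷ nothing ∷ w))
             (λ w → insertΣ (just a) w (G ∘ (nothing ∷_))))
           (trans (∑-cong′ A (λ b → trans
             (distinctΣ-cong A N (avoid-+ b (λ w → G (just a ∷ just b ∷ w))
                (λ w → insertΣ (just a) w (G ∘ (just b ∷_)))))
             (distinctΣ-+ A N _ _)))
             (∑-+ A _ _)))
           rearrange) ⟨
    distinctΣ A (suc (suc N)) G + distinctΣ A (suc N) (λ w → insertΣ (just a) w G) ∎
    where
    x₁ = distinctΣ A (suc N) (G ∘ (nothing ∷_))
    x₂ = distinctΣ A N (λ w → insertΣ (just a) w (G ∘ (nothing ∷_)))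
    x₃ = distinctΣ A (suc N) (G ∘ (just a ∷_))
    x₄ = ∑ A (λ b → distinctΣ A (suc N) (avoid b (G ∘ (just b ∷_))))
    x₅ = ∑ A (λ b → distinctΣ A N (avoid b (λ w → insertΣ (just a) w (G ∘ (just b ∷_)))))
    x₆ = ∑ A (λ b → distinctΣ A N (avoid b (λ w → G (just a ∷ just b ∷ w))))
    x₇ = distinctΣ A N (λ w → G (just a ∷ nothing ∷ w))
    rearrange : (x₇ + x₂) + (x₆ + x₅) ≈ x₃ + (x₂ + x₅)
    rearrange = solve 4 (λ a b c d → (a :+ b) :+ (c :+ d) := (a :+ c) :+ (b :+ d))
      refl x₇ x₂ x₆ x₅

  -- Peeling decides for each numeral whether it belongs to the content S; the insertions accumulate
  -- into `contentΣ`, and in the end only holes remain. The smallest numeral is peeled first, which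
  -- is why it is inserted last.
  distinctΣ-by-content : ∀ A → AllPairs (λ a b → toℕ a <ℕ toℕ b) A → ∀ {G H} →
    (∀ j S → S ⊆ A → contentΣ nothing j (map just S) G ≈ contentΣ nothing j (map just S) H) →
    ∀ N → distinctΣ A N G ≈ distinctΣ A N H
  distinctΣ-by-content [] _ e N = trans (holes N) (trans (e N [] []) (sym (holes N)))
    where
    holes : ∀ N {G} → distinctΣ [] N G ≈ shuffleΣ nothing N [] G
    holes zero    = refl
    holes (suc N) = trans (+-identityʳ _) (holes N)
  distinctΣ-by-content (a ∷ A) (a<A ∷ A↗) {G} {H} e zero    =
    distinctΣ-by-content A A↗ {G} {H} (λ j S S⊆A → e j S (skip a S⊆A)) zero
  distinctΣ-by-content (a ∷ A) (a<A ∷ A↗) {G} {H} e (suc N) = begin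
    distinctΣ (a ∷ A) (suc N) G
      ≈⟨ distinctΣ-peel a A a#A N G ⟩
    distinctΣ A (suc N) G + distinctΣ A N (λ w → insertΣ (just a) w G)
      ≈⟨ +-cong
          (distinctΣ-by-content A A↗ {G} {H} (λ j S S⊆A → e j S (skip a S⊆A)) (suc N))
          (distinctΣ-by-content A A↗ (λ j S S⊆A → e j (a ∷ S) (≡.refl ∷ S⊆A)) N) ⟩
    distinctΣ A (suc N) H + distinctΣ A N (λ w → insertΣ (just a) w H)
      ≈⟨ distinctΣ-peel a A a#A N H ⟨
    distinctΣ (a ∷ A) (suc N) H ∎
    where a#A = All.map <⇒Apart a<A

  -- That the first numeral does not recur is absorbed into the summand by `avoid`; distinctness
  -- within the tail is left to the induction.
  ∑-allVecs : ∀ A N (G : List (Letter n) → Carrier) →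
    ∑ (allVecs (nothing ∷ map just A) N)
      (λ π → if allDistinct (numerals (toList π)) then G (toList π) else 0#) ≈ distinctΣ A N G
  ∑-allVecs A zero    G = +-identityʳ _
  ∑-allVecs A (suc N) G = begin
    ∑ (allVecs (nothing ∷ map just A) (suc N)) f
      ≈⟨ ∑-concatMap (λ x → map (x Vec.∷_) words) (nothing ∷ map just A) f ⟩
    ∑ (map (nothing Vec.∷_) words) f + ∑ (map just A) (λ x → ∑ (map (x Vec.∷_) words) f)
      ≈⟨ +-cong (trans (reflexive (∑-map _ words f)) (∑-allVecs A N _))
          (trans (reflexive (∑-map just A _)) (∑-cong′ A first)) ⟩
    distinctΣ A (suc N) G ∎
    where
    words = allVecs (nothing ∷ map just A) N
    f : Vec (Letter n) (suc N) → Carrier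
    f π = if allDistinct (numerals (toList π)) then G (toList π) else 0#
    split : ∀ a b x →
      (if not a ∧ b then x else 0#) ≈ (if b then (if a then 0# else x) else 0#)
    split true  true  x = refl
    split true  false x = refl
    split false b     x = refl
    first : ∀ a → ∑ (map (just a Vec.∷_) words) f ≈ distinctΣ A N (avoid a (G ∘ (just a ∷_)))
    first a = begin
      ∑ (map (just a Vec.∷_) words) f
        ≡⟨ ∑-map _ words f ⟩
      ∑ words (λ π → f (just a Vec.∷ π))
        ≈⟨ ∑-cong′ words (λ π → split (occurs (toList π) a) _ _) ⟩
      ∑ words (λ π → if allDistinct (numerals (toList π))
        then avoid a (G ∘ (just a ∷_)) (toList π) else 0#)
        ≈⟨ ∑-allVecs A N _ ⟩
      distinctΣ A N (avoid a (G ∘ (just a ∷_))) ∎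

  -- The factor that depends only on the content.

  contentWeight : List (Letter n) → Carrier
  contentWeight w = if countB isHole w ≡ᵇ k then q ^ invLetters w else 0#

  -- The number of holes and the set of numerals survive rearrangement, so this weight can be pulled
  -- out of a sum over one content.
  contentWeight-↭ : ∀ {u v} → u ↭ v → contentWeight u ≡ contentWeight v
  contentWeight-↭ r = ≡.cong₂ (λ j m → if j ≡ᵇ k then q ^ m else 0#)
    (countB-↭ isHole r) (invLetters-↭ r)

  ∑-PP : ∀ (f : Word n → Carrier) (F : List (Letter n) → Carrier) →
    (∀ π → f π ≈ q ^ invSS π * F (toList π)) →
    ∑ (PP n k) f ≈ distinctΣ (allFin n) n (λ w → contentWeight w * F w)
  ∑-PP f F e = begin
    ∑ (PP n k) f
      ≡⟨ ≡.cong (λ πs → ∑ πs f) PP≡filterᵇ ⟩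
    ∑ (filterᵇ (isPartialPerm k) words) f
      ≈⟨ ∑-filterᵇ (isPartialPerm k) f words ⟩
    ∑ words (λ π → if isPartialPerm k π then f π else 0#)
      ≈⟨ ∑-cong′ words (λ π → trans
           (split (countB isHole (toList π) ≡ᵇ k) (allDistinct (numerals (toList π))) (e π))
           (reflexive (≡.cong (λ m → if allDistinct (numerals (toList π)) then
              (if countB isHole (toList π) ≡ᵇ k then q ^ m else 0#) * F (toList π) else 0#)
              (invSS≡invLetters π)))) ⟩
    ∑ words (λ π → if allDistinct (numerals (toList π))
      then contentWeight (toList π) * F (toList π) else 0#)
      ≈⟨ ∑-allVecs (allFin n) n _ ⟩
    distinctΣ (allFin n) n (λ w → contentWeight w * F w) ∎
    where
    words = allVecs (allLetters n) n
    split : ∀ a b {x u v} → x ≈ u * v →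
      (if a ∧ b then x else 0#) ≈ (if b then (if a then u else 0#) * v else 0#)
    split true  true  e = e
    split true  false e = refl
    split false true  e = sym (zeroˡ _)
    split false false e = refl

  -- Equality at x = 1 and return to the original summands.

  no-letters : Letter n → ℕ
  no-letters _ = 0

  -- The test function that sets x = 1 and so undoes the homogenisation.
  one : ℕ → Carrier
  one _ = 1#

  equal-content : distinctΣ (allFin n) n (λ w → contentWeight w * Φ no-letters w one) ≈
    distinctΣ (allFin n) n (λ w → contentWeight w * Ψ w one)
  equal-content = distinctΣ-by-content (allFin n) increasing (λ j S S⊆ →
    let S↗ = AllPairs.map⁺ (AllPairs.map <⇒≺ᴸ (AllPairs-resp-⊆ S⊆ increasing))
        S≺h = All.map⁺ (All.universal (λ _ → ≡.refl , ≡.refl) S)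
    in trans (factor j S (λ w → Φ no-letters w one)) (trans (*-congˡ (trans
        (content-Φ >ᴸ-irrefl nothing j (map just S) S↗ S≺h one)
        (sym (content-Ψ nothing ≡.refl j (map just S) S↗ S≺h one))))
        (sym (factor j S (λ w → Ψ w one))))) n
    where
    increasing = AllPairs.tabulate⁺-< id
    factor : ∀ j S F → contentΣ nothing j (map just S) (λ w → contentWeight w * F w) ≈
      contentWeight (map just S ++ replicate j nothing) * contentΣ nothing j (map just S) F
    factor j S F = trans
      (contentΣ-cong nothing j (map just S) (λ v v↭ → *-congʳ (reflexive (contentWeight-↭ v↭))))
      (contentΣ-* nothing j (map just S) _ F)

  -- Induction on a suffix w of π. The prefix p fixes the positions: o is its length, ν counts its
  -- letters exceeding a given one, and f lists the remaining positions. A letter contributes q^ν,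
  -- times 1 + z/q^(1+ν) at a descent, which is q^ν + y there because y = z/q.
  inv-product : ∀ (π : Word n) p w → toList π ≡ p ++ w →
    ∀ ν → (∀ x → ν x ≡ countB (_>ᴸ x) p) → ∀ o → o ≡ length p →
    ∀ f → (∀ i → f i ≡ suc (o +ℕ i)) →
    q ^ foldr _+ℕ_ 0 (map (invBox π) (applyUpTo f (length w))) *
      Π[ map (λ i → 1# + z * q⁻¹ ^ suc (invBox π i)) (descentsFrom o w) ] ≈ Φ ν w one
  inv-product π p []      e ν ν≡ o o≡ f f≡ = *-identityˡ 1#
  inv-product π p (a ∷ w) e ν ν≡ o o≡ f f≡ = begin
    q ^ (invBox π (f 0) +ℕ s) * Π[ map wt (descentsFrom o (a ∷ w)) ]
      ≈⟨ *-congʳ (trans (^-congʳ q (≡.cong (_+ℕ s) box-f0)) (^-homo-* q (ν a) s)) ⟩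
    (q ^ ν a * q ^ s) * Π[ map wt (descentsFrom o (a ∷ w)) ]
      ≈⟨ *-congˡ (product w) ⟩
    (q ^ ν a * q ^ s) * ((if descends a w then wt (suc o) else 1#) * P)
      ≈⟨ factor (descends a w) ⟩
    q ^ ν a * (q ^ s * P) + descent a w * (q ^ s * P)
      ≈⟨ +-cong (*-congˡ ih) (*-congˡ ih) ⟩
    Φ ν (a ∷ w) one ∎
    where
    wt : ℕ → Carrier
    wt i = 1# + z * q⁻¹ ^ suc (invBox π i)
    s = foldr _+ℕ_ 0 (map (invBox π) (applyUpTo (f ∘ suc) (length w)))
    P = Π[ map wt (descentsFrom (suc o) w) ]
    box : invBox π (suc o) ≡ ν a
    box = ≡.trans (≡.cong (invBox π ∘ suc) o≡) (≡.trans (invBox-at π p a w e) (≡.sym (ν≡ a)))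
    box-f0 : invBox π (f 0) ≡ ν a
    box-f0 = ≡.trans (≡.cong (invBox π) (≡.trans (f≡ 0) (≡.cong suc (+ℕ-identityʳ o)))) box
    ih : q ^ s * P ≈ Φ (ν ⊕ a) w one
    ih = inv-product π (p ∷ʳ a) w (≡.trans e (≡.sym (List.++-assoc p (a ∷ []) w)))
      (ν ⊕ a)
      (λ x → ≡.trans (≡.cong ((if a >ᴸ x then 1 else 0) +ℕ_) (ν≡ x))
        (≡.sym (countB-∷ʳ (_>ᴸ x) p a)))
      (suc o) (≡.trans (≡.cong suc o≡) (≡.sym (List.length-++-comm p (a ∷ []))))
      (f ∘ suc) (λ i → ≡.trans (f≡ (suc i)) (≡.cong suc (+ℕ-suc o i)))
    product : ∀ w → Π[ map wt (descentsFrom o (a ∷ w)) ] ≈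
      (if descends a w then wt (suc o) else 1#) * Π[ map wt (descentsFrom (suc o) w) ]
    product []      = sym (*-identityˡ _)
    product (b ∷ w) with a >ᴸ b
    ... | true  = refl
    ... | false = sym (*-identityˡ _)
    factor : ∀ d → (q ^ ν a * q ^ s) * ((if d then wt (suc o) else 1#) * P) ≈
      q ^ ν a * (q ^ s * P) + (if d then y else 0#) * (q ^ s * P)
    factor false = solve 3 (λ a b c →
      (a :* b) :* (con 1 :* c) := a :* (b :* c) :+ con 0 :* (b :* c)) refl
      (q ^ ν a) (q ^ s) P
    factor true  = begin
      (q ^ ν a * q ^ s) * ((1# + z * q⁻¹ ^ suc (invBox π (suc o))) * P)
        ≈⟨ *-congˡ (*-congʳ (+-congˡ (*-congˡ (^-congʳ q⁻¹ (≡.cong suc box))))) ⟩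
      (q ^ ν a * q ^ s) * ((1# + z * (q⁻¹ * q⁻¹ ^ ν a)) * P)
        ≈⟨ solve 6 (λ a s z j i p → (a :* s) :* ((con 1 :+ z :* (j :* i)) :* p) :=
              a :* (s :* p) :+ (a :* i) :* ((z :* j) :* (s :* p))) refl
              (q ^ ν a) (q ^ s) z q⁻¹ (q⁻¹ ^ ν a) P ⟩
      q ^ ν a * (q ^ s * P) + (q ^ ν a * q⁻¹ ^ ν a) * (y * (q ^ s * P))
        ≈⟨ +-congˡ (trans (*-congʳ (^-cancel (ν a))) (*-identityˡ _)) ⟩
      q ^ ν a * (q ^ s * P) + y * (q ^ s * P) ∎

  Π-∷ʳ : ∀ xs x → Π[ xs ∷ʳ x ] ≈ Π[ xs ] * x
  Π-∷ʳ []       x = trans (*-identityʳ x) (sym (*-identityˡ x))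
  Π-∷ʳ (a ∷ xs) x = trans (*-congˡ (Π-∷ʳ xs x)) (sym (*-assoc _ _ _))

  -- At x = 1 the factor x + y q^(1-i) becomes 1 + z q^(-i).
  Q-one : ∀ d e → Q d e one ≈ Π[ map (λ i → 1# + z * q⁻¹ ^ i) (applyUpTo suc d) ]
  Q-one zero    e = refl
  Q-one (suc d) e = begin
    Q d e one + (y * q⁻¹ ^ d) * Q d e one
      ≈⟨ +-cong (Q-one d e) (*-congˡ (Q-one d e)) ⟩
    P + ((z * q⁻¹) * q⁻¹ ^ d) * P
      ≈⟨ solve 4 (λ z j i p → p :+ ((z :* j) :* i) :* p := p :* (con 1 :+ z :* (j :* i))) refl
           z q⁻¹ (q⁻¹ ^ d) P ⟩
    P * wt (suc d)
      ≈⟨ Π-∷ʳ (map wt (applyUpTo suc d)) (wt (suc d)) ⟨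
    Π[ map wt (applyUpTo suc d) ∷ʳ wt (suc d) ]
      ≡⟨ ≡.cong Π[_] (≡.trans (≡.sym (List.map-++ wt (applyUpTo suc d) (suc d ∷ [])))
           (≡.cong (map wt) (List.applyUpTo-∷ʳ suc d))) ⟩
    Π[ map wt (applyUpTo suc (suc d)) ] ∎
    where
    wt : ℕ → Carrier
    wt i = 1# + z * q⁻¹ ^ i
    P = Π[ map wt (applyUpTo suc d) ]

  inv-term : ∀ (π : Word n) →
    q ^ inv π * Π[ map (λ i → 1# + z * q⁻¹ ^ suc (invBox π i)) (Des π) ] ≈
    q ^ invSS π * Φ no-letters (toList π) one
  inv-term π = begin
    q ^ (inv₀ π +ℕ invSS π) * P
      ≈⟨ *-congʳ (^-homo-* q (inv₀ π) (invSS π)) ⟩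
    (q ^ inv₀ π * q ^ invSS π) * P
      ≈⟨ solve 3 (λ a b c → (a :* b) :* c := b :* (a :* c)) refl (q ^ inv₀ π) (q ^ invSS π) P ⟩
    q ^ invSS π * (q ^ inv₀ π * P)
      ≡⟨ ≡.cong (λ m → q ^ invSS π * (q ^ foldr _+ℕ_ 0 (map (invBox π) (applyUpTo suc m)) * P))
           (≡.sym (Vec.length-toList π)) ⟩
    q ^ invSS π * (q ^ foldr _+ℕ_ 0 (map (invBox π) (applyUpTo suc (length (toList π)))) * P)
      ≈⟨ *-congˡ (inv-product π [] (toList π) ≡.refl no-letters (λ _ → ≡.refl)
           0 ≡.refl suc (λ _ → ≡.refl)) ⟩
    q ^ invSS π * Φ no-letters (toList π) one ∎
    where P = Π[ map (λ i → 1# + z * q⁻¹ ^ suc (invBox π i)) (Des π) ]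

  maj-term : ∀ (π : Word n) →
    q ^ maj π * Π[ map (λ i → 1# + z * q⁻¹ ^ i) (applyUpTo suc (des π)) ] ≈
    q ^ invSS π * Ψ (toList π) one
  maj-term π = begin
    q ^ (maj₀ π +ℕ invSS π) * P (des π)
      ≈⟨ *-cong (^-homo-* q (maj₀ π) (invSS π)) (reflexive (≡.cong P (des≡descents 0 w))) ⟩
    (q ^ maj₀ π * q ^ invSS π) * P (descents w)
      ≈⟨ *-cong (*-congʳ (^-congʳ q (maj₀≡major w))) (sym (Q-one (descents w) (ascents w))) ⟩
    (q ^ major w * q ^ invSS π) * Q (descents w) (ascents w) one
      ≈⟨ solve 3 (λ a b c → (a :* b) :* c := b :* (a :* c)) refl _ _ _ ⟩
    q ^ invSS π * Ψ (toList π) one ∎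
    where
    w = toList π
    P : ℕ → Carrier
    P d = Π[ map (λ i → 1# + z * q⁻¹ ^ i) (applyUpTo suc d) ]

  LHS≈RHS : LHS q q⁻¹ z n k ≈ RHS q q⁻¹ z n k
  LHS≈RHS = begin
    LHS q q⁻¹ z n k
      ≈⟨ ∑-PP _ (λ w → Φ no-letters w one) inv-term ⟩
    distinctΣ (allFin n) n (λ w → contentWeight w * Φ no-letters w one)
      ≈⟨ equal-content ⟩
    distinctΣ (allFin n) n (λ w → contentWeight w * Ψ w one)
      ≈⟨ ∑-PP _ (λ w → Ψ w one) maj-term ⟨
    RHS q q⁻¹ z n k ∎

theorem2p2 : ∀ {c ℓ : Level} (R : CommutativeRing c ℓ) →
    let open CommutativeRing R in
    (q q⁻¹ z : Carrier) → q * q⁻¹ ≈ 1# →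
    (n k : ℕ) → k ≤ n →
    Gen.LHS R q q⁻¹ z n k ≈ Gen.RHS R q q⁻¹ z n k
theorem2p2 R q q⁻¹ z q*q⁻¹≈1 n k _ = Equidistribution.LHS≈RHS R q q⁻¹ z q*q⁻¹≈1 n k
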